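{- Let $G=(V,E)$ be a directed acyclic graph with $n$ vertices and $m$ edges, let $S_p=\{P_1,\dots,P_k\}$ be a path decomposition of $G$ with $k$ paths, with path decomposition graph $H=(V,A)$, and let $T$ be a topological order of $G$. Given this input, Algorithm PCH-Draw computes a (path constrained hierarchical) drawing $\Gamma$ of $G$ in $O(n+mk)$ time. Furthermore, $\mathrm{Area}(\Gamma)=O(kn)$.
   Context: A path decomposition of a DAG $G=(V,E)$ is a set $S_p=\{P_1,\dots,P_k\}$ of vertex-disjoint directed paths of $G$ whose vertex sets partition $V$; its members are called decomposition paths (each is ordered along the path). The path decomposition graph associated with $S_p$ is $H=(V,A)$, where $e=(u,v)\in A$ if and only if $e\in E$ and either (a) $u,v$ are consecutive vertices of a path of $S_p$ ("path edge"), or (b) $u$ and $v$ belong to different paths of $S_p$ ("cross edge"). A hierarchical drawing of an acyclic directed graph is one in which all edges are drawn monotonically in the same direction (upward). A path constrained hierarchical drawing (PCH drawing) of $G$ given $S_p$ is a hierarchical drawing of $H$ in which two vertices have the same $x$-coordinate if and only if they belong to the same decomposition path. Let $T(v)\in\{1,\dots,n\}$ be the position of $v$ in a fixed topological order of $G$. Algorithm PCH-Draw$(G,S_p,H)$: assign to each path the $x$-coordinate $X(P_i)=2i$, and place each vertex $v$ at $(X(v),Y(v))=(X(P_v),T(v))$, where $P_v$ is the path of $S_p$ containing $v$. For every edge $e=(u,v)\in A$: if the straight segment from $u$ to $v$ contains no vertex other than $u,v$, draw $e$ as that straight segment; otherwise draw $e$ as a polyline with one bend at the point $b_e=(X(b_e),Y(b_e))$,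 where $X(b_e)=X(u)+1$ if $X(u)<X(v)$, $X(b_e)=X(u)-1$ otherwise, and $Y(b_e)=Y(v)-1$. The area of a drawing is measured by its axis-parallel bounding rectangle on the integer grid. -}

module Defs where

open import Data.Bool.Base using (Bool; true; false; if_then_else_; _∧_)
open import Data.Fin.Base as Fin using (Fin; toℕ)
open import Data.Fin.Permutation using (Permutation′; _⟨$⟩ʳ_)
open import Data.Integer.Base as ℤ using (ℤ; +_; ∣_∣)
open import Data.List.Base using (List; []; _∷_; _++_; map; concat; tabulate; take; length; foldr)
open import Data.List.Membership.Propositional using (_∈_)
open import Data.List.Relation.Unary.Linked using (Linked)
open import Data.List.Relation.Unary.Unique.Propositional using (Unique)
open import Data.Nat.Base using (ℕ; zero; suc; _+_; _*_; _∸_; _/_; _≡ᵇ_; _<ᵇ_; _≤_; _>_)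
open import Data.Product.Base using (∃-syntax; _×_; _,_; proj₁; proj₂)
open import Data.Sum.Base using (_⊎_)
open import Function.Base using (_∘_)
open import Function.Bundles using (_⇔_)
open import Function.Definitions using (Injective)
open import Relation.Binary.Construct.Closure.Transitive using (TransClosure)
open import Relation.Binary.PropositionalEquality.Core using (_≡_; _≢_)
open import Relation.Nullary.Negation.Core using (¬_)

-- Vertices are Fin n.  Edges are numbered by Fin m; injectivity says that
-- there are no parallel edges, so m is the number of edges.
record Digraph (n m : ℕ) : Set where
  field
    edge     : Fin m → Fin n × Fin n
    edge-inj : Injective _≡_ _≡_ edge

  src tgt : Fin m → Fin n
  src = proj₁ ∘ edge
  tgt = proj₂ ∘ edge

  _⟶_ : Fin n → Fin n → Set
  u ⟶ v = ∃[ e ] edge e ≡ (u , v)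

open Digraph public

Acyclic : ∀ {n m} → Digraph n m → Set
Acyclic G = ∀ v → ¬ TransClosure (_⟶_ G) v v

IsTopologicalOrder : ∀ {n m} → Digraph n m → Permutation′ n → Set
IsTopologicalOrder G τ = ∀ u v → _⟶_ G u v → (τ ⟨$⟩ʳ u) Fin.< (τ ⟨$⟩ʳ v)

record PathDecomposition {n m : ℕ} (G : Digraph n m) (k : ℕ) : Set where
  field
    path      : Fin k → List (Fin n)
    nonEmpty  : ∀ i → path i ≢ []
    directed  : ∀ i → Linked (_⟶_ G) (path i)
    simple    : ∀ i → Unique (path i)
    covers    : ∀ v → ∃[ i ] v ∈ path i
    disjoint  : ∀ {i j v} → v ∈ path i → v ∈ path j → i ≡ j

  SamePath : Fin n → Fin n → Set
  SamePath u v = ∃[ i ] (u ∈ path i × v ∈ path i)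

  DifferentPaths : Fin n → Fin n → Set
  DifferentPaths u v = ∃[ i ] ∃[ j ] (u ∈ path i × v ∈ path j × i ≢ j)

  Consecutive : Fin n → Fin n → Set
  Consecutive u v = ∃[ i ] ∃[ xs ] ∃[ ys ] path i ≡ xs ++ u ∷ v ∷ ys

open PathDecomposition public

IsPathDecompositionGraph : ∀ {n m k a} (G : Digraph n m) →
                           PathDecomposition G k → Digraph n a → Set
IsPathDecompositionGraph G S H =
  ∀ u v → _⟶_ H u v ⇔ (_⟶_ G u v × (Consecutive S u v ⊎ DifferentPaths S u v))

record Input : Set where
  field
    n m k a : ℕ
    G       : Digraph n m
    acyclic : Acyclic G
    S       : PathDecomposition G k
    H       : Digraph n a
    isPDG   : IsPathDecompositionGraph G S H
    τ       : Permutation′ n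
    isTopo  : IsTopologicalOrder G τ

  -- Positions in the order run from 1 to n.
  T : Fin n → ℕ
  T v = suc (toℕ (τ ⟨$⟩ʳ v))

Point : Set
Point = ℤ × ℤ

X Y : Point → ℤ
X = proj₁
Y = proj₂

-- p = (s a + t b) / (s + t) with s, t ≥ 0 not both zero.  For grid points the
-- real convex-combination coefficients can always be chosen rational.
OnSegment : Point → Point → Point → Set
OnSegment p a b = ∃[ s ] ∃[ t ]
  ( s + t > 0
  × (+ (s + t)) ℤ.* X p ≡ (+ s) ℤ.* X a ℤ.+ (+ t) ℤ.* X b
  × (+ (s + t)) ℤ.* Y p ≡ (+ s) ℤ.* Y a ℤ.+ (+ t) ℤ.* Y b )

record Drawing (n a : ℕ) : Set where
  field
    pos   : Fin n → Point
    bends : Fin a → List Point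

open Drawing public

polyline : ∀ {n a} → Digraph n a → Drawing n a → Fin a → List Point
polyline H Γ e = pos Γ (src H e) ∷ bends Γ e ++ pos Γ (tgt H e) ∷ []

record IsHierarchicalDrawing {n a} (H : Digraph n a) (Γ : Drawing n a) : Set where
  field
    distinct : Injective _≡_ _≡_ (pos Γ)
    avoids   : ∀ e w → w ≢ src H e → w ≢ tgt H e →
               Linked (λ p q → ¬ OnSegment (pos Γ w) p q) (polyline H Γ e)
    upward   : ∀ e → Linked (λ p q → Y p ℤ.< Y q) (polyline H Γ e)

record IsPCHDrawing {n m k a} {G : Digraph n m} (S : PathDecomposition G k)
                    (H : Digraph n a) (Γ : Drawing n a) : Set where
  field
    hierarchical : IsHierarchicalDrawing H Γ
    columns      : ∀ u v → X (pos Γ u) ≡ X (pos Γ v) ⇔ SamePath S u v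

-- The number of grid lines that meet the interval spanned by the coordinates.
-- (Counting lines rather than taking max − min keeps a drawing on a single
-- vertical line from having area 0; it can only make the area larger.)
extent : List ℤ → ℕ
extent []       = 0
extent (z ∷ zs) = suc ∣ foldr ℤ._⊔_ z zs ℤ.- foldr ℤ._⊓_ z zs ∣

drawnPoints : ∀ {n a} → Drawing n a → List Point
drawnPoints Γ = tabulate (pos Γ) ++ concat (tabulate (bends Γ))

Area : ∀ {n a} → Drawing n a → ℕ
Area Γ = extent (map X (drawnPoints Γ)) * extent (map Y (drawnPoints Γ))

module _ (I : Input) where
  open Input I

  Blocked : Drawing n a → Fin a → Set
  Blocked Γ e = ∃[ w ] ( w ≢ src H e × w ≢ tgt H e
                       × OnSegment (pos Γ w) (pos Γ (src H e)) (pos Γ (tgt H e)) )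

  IsBend : Drawing n a → Fin a → Point → Set
  IsBend Γ e b =
      (  X u ℤ.< X v → X b ≡ X u ℤ.+ (+ 1))
    × (¬ X u ℤ.< X v → X b ≡ X u ℤ.- (+ 1))
    × Y b ≡ Y v ℤ.- (+ 1)
    where
    u = pos Γ (src H e)
    v = pos Γ (tgt H e)

  -- toℕ i + 1 is the 1-based index of path i.
  record FollowsPCHDraw (Γ : Drawing n a) : Set where
    field
      placement : ∀ i v → v ∈ path S i → pos Γ v ≡ (+ (2 * suc (toℕ i)) , + T v)
      straight  : ∀ e → ¬ Blocked Γ e → bends Γ e ≡ []
      bent      : ∀ e → Blocked Γ e → ∃[ b ] (bends Γ e ≡ b ∷ [] × IsBend Γ e b)

-- Programs are syntax trees over an abstract type W of machine words
-- (parametric HOAS): a program that is polymorphic in W can neither inspect a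
-- word nor combine words except through the primitives below, each of which
-- is charged by exec.  Memory consists of finitely many named arrays.  Words
-- are unbounded, but pchDraw only produces numbers polynomial in n and k, so
-- it makes no illegitimate use of the unit-cost multiplication and division.

data Arr : Set where
  start vtx srcs tgts topo x y at bentE bendX bendY : Arr

code : Arr → ℕ
code start = 0
code vtx   = 1
code srcs  = 2
code tgts  = 3
code topo  = 4
code x     = 5
code y     = 6
code at    = 7
code bentE = 8
code bendX = 9
code bendY = 10

Mem : Set
Mem = Arr → ℕ → ℕ

write : Arr → ℕ → ℕ → Mem → Mem
write r i w σ s j = if (code r ≡ᵇ code s) ∧ (i ≡ᵇ j) then w else σ s j

infixl 9 _[_]
infixl 7 _⊗_ _⊘_
infixl 6 _⊕_ _⊖_
infix  5 _≺_ _≐_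

data Exp (W : Set) : Set where
  `_          : W → Exp W
  lit         : ℕ → Exp W
  _[_]        : Arr → Exp W → Exp W
  _⊕_ _⊖_ _⊗_ _⊘_ _≺_ _≐_ : Exp W → Exp W → Exp W

infixr 1 _⨾_
infix  2 _[_]≔_

data Cmd (W : Set) : Set where
  skip   : Cmd W
  _[_]≔_ : Arr → Exp W → Exp W → Cmd W
  _⨾_    : Cmd W → Cmd W → Cmd W
  when   : Exp W → Cmd W → Cmd W → Cmd W
  Let    : Exp W → (W → Cmd W) → Cmd W
  For    : Exp W → Exp W → (W → Cmd W) → Cmd W

syntax when t c d         = when t then c otherwise d
syntax Let t (λ w → c)    = set w to t then c
syntax For l h (λ i → c)  = for i from l below h do′ c

infix 1 when
infix 1 Let
infix 1 For

boolean : Bool → ℕ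
boolean true  = 1
boolean false = 0

_div_ : ℕ → ℕ → ℕ
p div zero  = 0
p div suc q = p / suc q

eval : Exp ℕ → Mem → ℕ
eval (` w)   σ = w
eval (lit w) σ = w
eval (r [ t ]) σ = σ r (eval t σ)
eval (s ⊕ t) σ = eval s σ + eval t σ
eval (s ⊖ t) σ = eval s σ ∸ eval t σ
eval (s ⊗ t) σ = eval s σ * eval t σ
eval (s ⊘ t) σ = eval s σ div eval t σ
eval (s ≺ t) σ = boolean (eval s σ <ᵇ eval t σ)
eval (s ≐ t) σ = boolean (eval s σ ≡ᵇ eval t σ)

cost : Exp ℕ → ℕ
cost (` w)   = 1
cost (lit w) = 1
cost (r [ t ]) = suc (cost t)
cost (s ⊕ t) = suc (cost s + cost t)
cost (s ⊖ t) = suc (cost s + cost t)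
cost (s ⊗ t) = suc (cost s + cost t)
cost (s ⊘ t) = suc (cost s + cost t)
cost (s ≺ t) = suc (cost s + cost t)
cost (s ≐ t) = suc (cost s + cost t)

-- loop r i f runs f i, f (i + 1), …, f (i + r - 1), charging one unit per
-- iteration on top of the cost of the body.
loop : ℕ → ℕ → (ℕ → Mem → Mem × ℕ) → Mem → Mem × ℕ
loop zero    i f σ = σ , 0
loop (suc r) i f σ =
  let (σ₁ , t₁) = f i σ
      (σ₂ , t₂) = loop r (suc i) f σ₁
  in σ₂ , suc (t₁ + t₂)

-- Final memory and number of steps.  A nonzero test counts as true.
exec : Cmd ℕ → Mem → Mem × ℕ
exec skip           σ = σ , 1
exec (r [ i ]≔ t)   σ = write r (eval i σ) (eval t σ) σ , suc (cost i + cost t)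
exec (c ⨾ d)        σ =
  let (σ₁ , t₁) = exec c σ
      (σ₂ , t₂) = exec d σ₁
  in σ₂ , t₁ + t₂
exec (when t c d)   σ =
  let (σ₁ , t₁) = if eval t σ ≡ᵇ 0 then exec d σ else exec c σ
  in σ₁ , suc (cost t + t₁)
exec (Let t c)      σ =
  let (σ₁ , t₁) = exec (c (eval t σ)) σ
  in σ₁ , suc (cost t + t₁)
exec (For l h c)    σ =
  let (σ₁ , t₁) = loop (eval h σ ∸ eval l σ) (eval l σ) (λ i → exec (c i)) σ
  in σ₁ , suc (cost l + cost h + t₁)

module _ {W : Set} where

  private
    infixr 4 _and_
    infixr 3 _or_

    _and_ _or_ : Exp W → Exp W → Exp W
    s and t = s ⊗ t
    s or  t = s ⊕ t

    dist : Exp W → Exp W → Exp W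
    dist s t = (s ⊖ t) ⊕ (t ⊖ s)

  placeVertices : W → W → Cmd W
  placeVertices n k =
    (for i from lit 0 below ` k do′
      for j from start [ ` i ] below start [ ` i ⊕ lit 1 ] do′
        x [ vtx [ ` j ] ]≔ lit 2 ⊗ (` i ⊕ lit 1))
    ⨾
    (for v from lit 0 below ` n do′
      (y [ ` v ]≔ topo [ ` v ] ⨾
       at [ topo [ ` v ] ]≔ ` v))

  -- Does the segment from u to v meet a vertex in column c, strictly between
  -- the two columns?  It meets that column in a single point, at height
  -- y u + |c - x u| (y v - y u) / |x v - x u|, and if this is a grid point then
  -- the only vertex at that height is the one recorded in the array `at`.
  -- A segment inside one column is that of a path edge, which is never blocked.
  testColumn : W → W → W → W → Cmd W
  testColumn e u v c =
    when (x [ ` u ] ≺ ` c and ` c ≺ x [ ` v ]) or (x [ ` v ] ≺ ` c and ` c ≺ x [ ` u ])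
    then
      (set p to dist (` c) (x [ ` u ]) ⊗ (y [ ` v ] ⊖ y [ ` u ]) then
       set q to dist (x [ ` v ]) (x [ ` u ]) then
       set h to ` p ⊘ ` q then
       when (` h ⊗ ` q ≐ ` p) and (x [ at [ y [ ` u ] ⊕ ` h ] ] ≐ ` c)
       then bentE [ ` e ]≔ lit 1
       otherwise skip)
    otherwise skip

  placeBend : W → W → W → Cmd W
  placeBend e u v =
    (when x [ ` u ] ≺ x [ ` v ]
     then bendX [ ` e ]≔ x [ ` u ] ⊕ lit 1
     otherwise (bendX [ ` e ]≔ x [ ` u ] ⊖ lit 1))
    ⨾
    bendY [ ` e ]≔ y [ ` v ] ⊖ lit 1

  routeEdges : W → W → Cmd W
  routeEdges k a =
    for e from lit 0 below ` a do′
      set u to srcs [ ` e ] then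
      set v to tgts [ ` e ] then
      (bentE [ ` e ]≔ lit 0
       ⨾
       (for i from lit 0 below ` k do′
         set c to lit 2 ⊗ (` i ⊕ lit 1) then
         testColumn e u v c)
       ⨾
       (when bentE [ ` e ] then placeBend e u v otherwise skip))

  pchDraw : W → W → W → Cmd W
  pchDraw n k a = placeVertices n k ⨾ routeEdges k a

cells : List ℕ → ℕ → ℕ
cells []       j       = 0
cells (w ∷ ws) zero    = w
cells (w ∷ ws) (suc j) = cells ws j

module _ (I : Input) where
  open Input I

  -- The paths are stored one after the other in vtx; path i occupies the
  -- cells from start[i] up to, but excluding, start[i + 1].
  memory : Mem
  memory start i = length (concat (take i (tabulate (path S))))
  memory vtx     = cells (map toℕ (concat (tabulate (path S))))
  memory srcs    = cells (tabulate (toℕ ∘ src H))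
  memory tgts    = cells (tabulate (toℕ ∘ tgt H))
  memory topo    = cells (tabulate T)
  memory _     _ = 0

  result : Mem × ℕ
  result = exec (pchDraw n k a) memory

  time : ℕ
  time = proj₂ result

  drawing : Drawing n a
  drawing = record
    { pos   = λ v → + out x (toℕ v) , + out y (toℕ v)
    ; bends = λ e → if out bentE (toℕ e) ≡ᵇ 0 then []
                    else (+ out bendX (toℕ e) , + out bendY (toℕ e)) ∷ []
    }
    where
    out : Mem
    out = proj₁ result

_=O_ : (Input → ℕ) → (Input → ℕ) → Set
f =O g = ∃[ c ] ∃[ N ] ∀ (I : Input) → N ≤ Input.n I → f I ≤ c * g I

{-# OPTIONS --safe #-}
module Submission where

-- Because the rows form a topological order, a vertex on the segment from u to
-- v lies strictly between u and v in both coordinates (a path edge is clear,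
-- since its endpoints are adjacent on an ascending column).  Such a vertex is met
-- in column c at the height y u + |c - x u| (y v - y u) / |x v - x u|, and its
-- row identifies it; so scanning the k columns decides blockedness.  A blocked
-- edge spans at least two rows, hence its bend lies strictly above u.  The bend
-- has an odd x-coordinate next to column u and lies one row below v, so
-- neither part of the polyline has room for a vertex in its interior.
-- The running time is amortised over the starts of the paths, using k ≤ n and
-- |A| ≤ m.

open import Data.Bool.Base as Bool using (true; false; if_then_else_)
open import Data.Fin.Base as Fin using (Fin; toℕ; fromℕ<)
open import Data.Fin.Permutation using (_⟨$⟩ʳ_; _⟨$⟩ˡ_; inverseʳ; inverseˡ)
open import Data.Fin.Properties using (toℕ<n; _≟_; toℕ-injective; toℕ-fromℕ<; injective⇒≤)
open import Data.Integer.Base as ℤ using (ℤ; +_; +<+)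
import Data.Integer.Properties as ℤ
open import Data.List.Base using (List; []; _∷_; _++_; map; concat; tabulate; take; drop; length; foldr; lookup)
open import Data.List.Membership.Propositional using (_∈_)
open import Data.List.Membership.Propositional.Properties using (∈-map⁺; ∈-map⁻; ∈-concat⁺′; ∈-tabulate⁺; ∈-++⁺ʳ; ∈-lookup)
open import Data.List.Properties using (length-++; length-map; map-++; concat-++; take++drop≡id; take-suc-tabulate; take-all; length-tabulate; ++-identityʳ; ++-assoc)
open import Data.List.Relation.Unary.All as All using (All; []; _∷_)
import Data.List.Relation.Unary.All.Properties as All
open import Data.List.Relation.Unary.AllPairs using (AllPairs; []; _∷_)
import Data.List.Relation.Unary.AllPairs.Properties as AllPairs
open import Data.List.Relation.Unary.Any using (here; there)
open import Data.List.Relation.Unary.Linked as Linked using (Linked; []; [-]; _∷_)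
open import Data.List.Relation.Unary.Linked.Properties using (Linked⇒AllPairs)
open import Data.List.Relation.Unary.Unique.Propositional using (Unique)
import Data.List.Relation.Unary.Unique.Propositional.Properties as Unique
open import Data.Nat.Base using (ℕ; zero; suc; _+_; _*_; _∸_; _⊔_; ∣_-_∣; _≡ᵇ_; _<ᵇ_; _≤_; _<_; _>_; z≤n; s≤s; s≤s⁻¹; >-nonZero)
open import Data.Nat.DivMod using (m*n/n≡m)
open import Data.Nat.Properties hiding (_≟_)
open import Data.Nat.Tactic.RingSolver using (solve-∀)
open import Data.Product.Base using (∃-syntax; _×_; _,_; proj₁; proj₂)
open import Data.Sum.Base as Sum using (_⊎_; inj₁; inj₂)
open import Data.Unit.Base using (⊤; tt)
open import Function.Base using (_∘_)
open import Function.Bundles using (Equivalence; mk⇔)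
open import Relation.Binary.Definitions using (tri<; tri≈; tri>)
open import Relation.Binary.PropositionalEquality using (_≡_; _≢_; refl; sym; trans; cong; cong₂; subst; subst₂; module ≡-Reasoning)
open import Relation.Nullary.Decidable.Core using (yes; no)
open import Relation.Nullary.Negation.Core using (¬_; contradiction)
open import Relation.Nullary.Reflects using (Reflects; ofʸ; ofⁿ; fromEquivalence)
open import Defs

-- Segments in ℕ

-- `Blocked` speaks of the finished drawing and of rational convex combinations, so it cannot serve
-- as an invariant while the program runs. The argument goes through `Crossed` instead, a condition
-- on the input alone, whose equation between natural numbers arises by clearing denominators. On
-- one side the program decides `Crossed`: an exact division followed by lookups in `at` and `x`
-- detects a solution. On the other side, for every edge of `H`, `Crossed` is equivalent to
-- `Blocked`. All coordinates of vertices and bends are nonnegative, so segments can be treated with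
-- weights in ℕ; horizontal distances are absolute differences, so that edges to the right and to
-- the left share one argument. Weights with `s + t = 0` satisfy every `OnInterval` equation, hence
-- the positivity hypotheses.

OnInterval : ℕ → ℕ → ℕ → ℕ → ℕ → Set
OnInterval s t p a b = (s + t) * p ≡ s * a + t * b

interval-swap : ∀ s t {p a b} → OnInterval s t p a b → OnInterval t s p b a
interval-swap s t {p} {a} {b} eq =
  trans (cong (_* p) (+-comm t s)) (trans eq (+-comm (s * a) (t * b)))

interval-end : ∀ {t p a b} → t > 0 → OnInterval 0 t p a b → p ≡ b
interval-end {t} {p} {b = b} t>0 = *-cancelˡ-≡ p b t {{>-nonZero t>0}}

interval-start : ∀ {s p a b} → s > 0 → OnInterval s 0 p a b → p ≡ a
interval-start {s} {p} {a} {b} s>0 eq = interval-end {a = b} s>0 (interval-swap s 0 {p} {a} {b} eq)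

interval-> : ∀ s t {p a b} → t > 0 → a < b → OnInterval s t p a b → a < p
interval-> s t {p} {a} {b} t>0 a<b eq = *-cancelˡ-< (s + t) a p (begin-strict
  (s + t) * a   ≡⟨ *-distribʳ-+ a s t ⟩
  s * a + t * a <⟨ +-monoʳ-< (s * a) (*-monoʳ-< t {{>-nonZero t>0}} a<b) ⟩
  s * a + t * b ≡⟨ eq ⟨
  (s + t) * p   ∎)
  where open ≤-Reasoning

interval-< : ∀ s t {p a b} → s > 0 → a < b → OnInterval s t p a b → p < b
interval-< s t {p} {a} {b} s>0 a<b eq = *-cancelˡ-< (s + t) p b (begin-strict
  (s + t) * p   ≡⟨ eq ⟩
  s * a + t * b <⟨ +-monoˡ-< (t * b) (*-monoʳ-< s {{>-nonZero s>0}} a<b) ⟩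
  s * b + t * b ≡⟨ *-distribʳ-+ b s t ⟨
  (s + t) * b   ∎)
  where open ≤-Reasoning

-- Strictly between `a` and `suc a` there is no integer. The vanishing weight is returned together
-- with the end, because the other coordinate uses the same weights and is thereby settled as well.
interval-unit : ∀ s t {p a} → s + t > 0 → OnInterval s t p a (suc a) →
                (p ≡ a × t ≡ 0) ⊎ (p ≡ suc a × s ≡ 0)
interval-unit zero    t       {a = a} s+t>0 eq = inj₂ (interval-end {a = a} s+t>0 eq , refl)
interval-unit (suc s) zero    {p} {a} s+t>0 eq = inj₁ (interval-start {suc s} {p} {a} {suc a} (s≤s z≤n) eq , refl)
interval-unit (suc s) (suc t) {p} {a} _ eq =
  contradiction (interval-> (suc s) (suc t) (s≤s z≤n) ≤-refl eq)
                (≤⇒≯ (s≤s⁻¹ (interval-< (suc s) (suc t) (s≤s z≤n) ≤-refl eq)))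

interval-distance : ∀ s t {p a b} → OnInterval s t p a b → (s + t) * ∣ p - a ∣ ≡ t * ∣ b - a ∣
interval-distance s t {p} {a} {b} eq = begin
  (s + t) * ∣ p - a ∣                    ≡⟨ *-distribˡ-∣-∣ (s + t) p a ⟩
  ∣ (s + t) * p - (s + t) * a ∣          ≡⟨ cong₂ ∣_-_∣ eq (*-distribʳ-+ a s t) ⟩
  ∣ s * a + t * b - (s * a + t * a) ∣    ≡⟨ ∣m+n-m+o∣≡∣n-o∣ (s * a) (t * b) (t * a) ⟩
  ∣ t * b - t * a ∣                      ≡⟨ *-distribˡ-∣-∣ t b a ⟨
  t * ∣ b - a ∣                          ∎
  where open ≡-Reasoning

∣m-n∣≡m∸n+n∸m : ∀ m n → ∣ m - n ∣ ≡ (m ∸ n) + (n ∸ m)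
∣m-n∣≡m∸n+n∸m zero    zero    = refl
∣m-n∣≡m∸n+n∸m zero    (suc n) = refl
∣m-n∣≡m∸n+n∸m (suc m) zero    = sym (+-identityʳ (suc m))
∣m-n∣≡m∸n+n∸m (suc m) (suc n) = ∣m-n∣≡m∸n+n∸m m n

∣m+n-m∣≡n : ∀ m n → ∣ m + n - m ∣ ≡ n
∣m+n-m∣≡n m n = trans (∣-∣-comm (m + n) m) (∣m-m+n∣≡n m n)

Between : ℕ → ℕ → ℕ → Set
Between a p b = (a < p × p < b) ⊎ (b < p × p < a)

interval-between : ∀ s t {p a b} → s > 0 → t > 0 → a ≢ b → OnInterval s t p a b → Between a p b
interval-between s t {a = a} {b} s>0 t>0 a≢b eq with <-cmp a b
... | tri< a<b _ _ = inj₁ (interval-> s t t>0 a<b eq , interval-< s t s>0 a<b eq)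
... | tri≈ _ a≡b _ = contradiction a≡b a≢b
... | tri> _ _ b<a = inj₂ (interval-> t s s>0 b<a (interval-swap s t eq) , interval-< t s t>0 b<a (interval-swap s t eq))

-- The segment from (a , c) to (b , d) passes the column p at height c + h.
Meets : (a b c d p h : ℕ) → Set
Meets a b c d p h = h * ∣ b - a ∣ ≡ ∣ p - a ∣ * (d ∸ c)

-- Both coordinates advance by the same fraction t/(s+t) of their range; equating the two forms of
-- this fraction eliminates the weights, which are unknown to the program. The hypothesis `c < d`
-- puts `q` above `c`, so that `q ∸ c` is a genuine difference.
interval⇒meets : ∀ s t {a b c d p q} → s > 0 → t > 0 → c < d →
                 OnInterval s t p a b → OnInterval s t q c d → Meets a b c d p (q ∸ c)
interval⇒meets s t {a} {b} {c} {d} {p} {q} s>0 t>0 c<d on-x on-y =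
  *-cancelˡ-≡ _ _ (s + t) {{>-nonZero (<-≤-trans s>0 (m≤m+n s t))}} (begin
    (s + t) * ((q ∸ c) * ∣ b - a ∣)   ≡⟨ *-assoc (s + t) (q ∸ c) _ ⟨
    (s + t) * (q ∸ c) * ∣ b - a ∣     ≡⟨ cong (_* ∣ b - a ∣) rise ⟩
    t * (d ∸ c) * ∣ b - a ∣           ≡⟨ rearrange t (d ∸ c) ∣ b - a ∣ ⟩
    t * ∣ b - a ∣ * (d ∸ c)           ≡⟨ cong (_* (d ∸ c)) (interval-distance s t on-x) ⟨
    (s + t) * ∣ p - a ∣ * (d ∸ c)     ≡⟨ *-assoc (s + t) ∣ p - a ∣ _ ⟩
    (s + t) * (∣ p - a ∣ * (d ∸ c))   ∎)
  where
  open ≡-Reasoning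

  rearrange : ∀ i j k → i * j * k ≡ i * k * j
  rearrange = solve-∀

  rise : (s + t) * (q ∸ c) ≡ t * (d ∸ c)
  rise = subst₂ (λ h g → (s + t) * h ≡ t * g)
    (m≤n⇒∣n-m∣≡n∸m (<⇒≤ (interval-> s t t>0 c<d on-y))) (m≤n⇒∣n-m∣≡n∸m (<⇒≤ c<d))
    (interval-distance s t on-y)

-- The weight of each end is the distance of `p` from the other end. These weights come from the
-- columns only; `meets⇒interval` shows that the same pair serves for the rows.
between⇒interval : ∀ {a b p} → Between a p b →
                   ∣ b - p ∣ + ∣ p - a ∣ ≡ ∣ b - a ∣ × OnInterval ∣ b - p ∣ ∣ p - a ∣ p a b
between⇒interval {a} (inj₁ (a<p , p<b))
  with t , refl ← m≤n⇒∃[o]m+o≡n (<⇒≤ a<p)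
  with s , refl ← m≤n⇒∃[o]m+o≡n (<⇒≤ p<b)
  rewrite ∣m+n-m∣≡n (a + t) s | ∣m+n-m∣≡n a t | +-assoc a t s | ∣m+n-m∣≡n a (t + s)
  = +-comm s t , weights a s t
  where
  weights : ∀ a s t → (s + t) * (a + t) ≡ s * a + t * (a + (t + s))
  weights = solve-∀
between⇒interval {b = b} (inj₂ (b<p , p<a))
  with s , refl ← m≤n⇒∃[o]m+o≡n (<⇒≤ b<p)
  with t , refl ← m≤n⇒∃[o]m+o≡n (<⇒≤ p<a)
  rewrite ∣m-m+n∣≡n (b + s) t | ∣m-m+n∣≡n b s | +-assoc b s t | ∣m-m+n∣≡n b (s + t)
  = refl , weights b s t
  where
  weights : ∀ b s t → (s + t) * (b + s) ≡ s * (b + (s + t)) + t * b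
  weights = solve-∀

between-distance : ∀ {a p b} → Between a p b → ∣ p - a ∣ < ∣ b - a ∣
between-distance {a} {p} {b} betw = subst (∣ p - a ∣ <_) (proj₁ (between⇒interval betw))
  (m<n+m ∣ p - a ∣ (n≢0⇒n>0 (λ z → apart betw (∣m-n∣≡0⇒m≡n z))))
  where
  apart : Between a p b → b ≢ p
  apart (inj₁ (_ , p<b)) = >⇒≢ p<b
  apart (inj₂ (b<p , _)) = <⇒≢ b<p

between-≢ : ∀ {a p b} → Between a p b → p ≢ a
between-≢ (inj₁ (a<p , _)) = >⇒≢ a<p
between-≢ (inj₂ (_ , p<a)) = <⇒≢ p<a

-- Read as a proportion, `Meets` says that `h` is the fraction |p - a| / |b - a| of the rise from
-- `c` to `d`, and this is exactly the share that the columns give to the far end.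
meets⇒interval : ∀ {a b c d p h} → c ≤ d → Between a p b → Meets a b c d p h →
                 OnInterval ∣ b - p ∣ ∣ p - a ∣ (c + h) c d
meets⇒interval {a} {b} {c} {d} {p} {h} c≤d betw meets
  with g , refl ← m≤n⇒∃[o]m+o≡n c≤d = begin
    (s + t) * (c + h)         ≡⟨ *-distribˡ-+ (s + t) c h ⟩
    (s + t) * c + (s + t) * h ≡⟨ cong (λ z → (s + t) * c + z) rise ⟩
    (s + t) * c + t * g       ≡⟨ regroup s t c g ⟩
    s * c + t * (c + g)       ∎
  where
  open ≡-Reasoning
  s = ∣ b - p ∣
  t = ∣ p - a ∣

  regroup : ∀ s t c g → (s + t) * c + t * g ≡ s * c + t * (c + g)
  regroup = solve-∀

  rise : (s + t) * h ≡ t * g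
  rise = begin
    (s + t) * h          ≡⟨ cong (_* h) (proj₁ (between⇒interval betw)) ⟩
    ∣ b - a ∣ * h        ≡⟨ *-comm ∣ b - a ∣ h ⟩
    h * ∣ b - a ∣        ≡⟨ meets ⟩
    t * (c + g ∸ c)      ≡⟨ cong (t *_) (m+n∸m≡n c g) ⟩
    t * g                ∎

-- A proper fraction of a positive rise is smaller than the rise. This keeps the computed row among
-- the rows of the vertices, where `at` has been filled.
meets-< : ∀ {a b c d p h} → c < d → Between a p b → Meets a b c d p h → c + h < d
meets-< {a} {b} {c} {d} {p} {h} c<d betw meets
  with g , refl ← m≤n⇒∃[o]m+o≡n (<⇒≤ c<d) = +-monoʳ-< c (*-cancelʳ-< ∣ b - a ∣ h g (begin-strict
    h * ∣ b - a ∣             ≡⟨ meets ⟩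
    ∣ p - a ∣ * (c + g ∸ c)   ≡⟨ cong (∣ p - a ∣ *_) (m+n∸m≡n c g) ⟩
    ∣ p - a ∣ * g             <⟨ *-monoˡ-< g {{>-nonZero g>0}} (between-distance betw) ⟩
    ∣ b - a ∣ * g             ≡⟨ *-comm ∣ b - a ∣ g ⟩
    g * ∣ b - a ∣             ∎))
  where
  open ≤-Reasoning
  g>0 : g > 0
  g>0 = +-cancelˡ-< c 0 g (subst (_< c + g) (sym (+-identityʳ c)) c<d)

interval⇒onSegment : ∀ s t {p q a b c d} → s + t > 0 → OnInterval s t p a b → OnInterval s t q c d →
                     OnSegment (+ p , + q) (+ a , + c) (+ b , + d)
interval⇒onSegment s t positive on-x on-y = s , t , positive , lift on-x , lift on-y
  where
  lift : ∀ {p a b} → OnInterval s t p a b → (+ (s + t)) ℤ.* (+ p) ≡ (+ s) ℤ.* (+ a) ℤ.+ (+ t) ℤ.* (+ b)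
  lift {p} {a} {b} eq = begin
    (+ (s + t)) ℤ.* (+ p)                   ≡⟨ ℤ.pos-* (s + t) p ⟨
    + ((s + t) * p)                         ≡⟨ cong +_ eq ⟩
    + (s * a + t * b)                       ≡⟨ ℤ.pos-+ (s * a) (t * b) ⟩
    + (s * a) ℤ.+ + (t * b)                 ≡⟨ cong₂ ℤ._+_ (ℤ.pos-* s a) (ℤ.pos-* t b) ⟩
    (+ s) ℤ.* (+ a) ℤ.+ (+ t) ℤ.* (+ b)     ∎
    where open ≡-Reasoning

onSegment⇒interval : ∀ {p q a b c d} → OnSegment (+ p , + q) (+ a , + c) (+ b , + d) →
                     ∃[ s ] ∃[ t ] (s + t > 0 × OnInterval s t p a b × OnInterval s t q c d)
onSegment⇒interval (s , t , positive , on-x , on-y) = s , t , positive , lower on-x , lower on-y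
  where
  lower : ∀ {p a b} → (+ (s + t)) ℤ.* (+ p) ≡ (+ s) ℤ.* (+ a) ℤ.+ (+ t) ℤ.* (+ b) → OnInterval s t p a b
  lower {p} {a} {b} eq = ℤ.+-injective (begin
    + ((s + t) * p)                         ≡⟨ ℤ.pos-* (s + t) p ⟩
    (+ (s + t)) ℤ.* (+ p)                   ≡⟨ eq ⟩
    (+ s) ℤ.* (+ a) ℤ.+ (+ t) ℤ.* (+ b)     ≡⟨ cong₂ ℤ._+_ (ℤ.pos-* s a) (ℤ.pos-* t b) ⟨
    + (s * a) ℤ.+ + (t * b)                 ≡⟨ ℤ.pos-+ (s * a) (t * b) ⟨
    + (s * a + t * b)                       ∎)
    where open ≡-Reasoning

-- Entries of `xs` have smaller values than `u` and entries of `ys` larger values than `v`.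
-- `AllPairs` provides these comparisons at any distance in the list.
ascending-adjacent : ∀ {A : Set} (f : A → ℕ) xs {u v w ys} →
  AllPairs (λ u v → f u < f v) (xs ++ u ∷ v ∷ ys) → w ∈ xs ++ u ∷ v ∷ ys → ¬ (f u < f w × f w < f v)
ascending-adjacent f [] _                     (here refl)         (u<w , _)   = <-irrefl refl u<w
ascending-adjacent f [] _                     (there (here refl)) (_ , w<v)   = <-irrefl refl w<v
ascending-adjacent f [] (_ ∷ v<ys ∷ _)        (there (there w∈))  (_ , w<v)   = <-asym w<v (All.lookup v<ys w∈)
ascending-adjacent f (z ∷ xs) (z< ∷ _)        (here refl)         (u<w , _)   =
  <-asym u<w (All.lookup z< (∈-++⁺ʳ xs (here refl)))
ascending-adjacent f (z ∷ xs) (_ ∷ ascending) (there w∈)          between     =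
  ascending-adjacent f xs ascending w∈ between

-- Reasoning about programs

run : Cmd ℕ → Mem → Mem
run c σ = proj₁ (exec c σ)

steps : Cmd ℕ → Mem → ℕ
steps c σ = proj₂ (exec c σ)

-- Truth is any nonzero word: the program writes conjunction as a product and disjunction as a sum,
-- and such values need not be 0 or 1.
data Decides (P : Set) : ℕ → Set where
  refuted   : ¬ P → Decides P 0
  confirmed : ∀ {w} → P → Decides P (suc w)

decides-map : ∀ {P Q : Set} {w} → (P → Q) → (Q → P) → Decides P w → Decides Q w
decides-map f g (refuted ¬p)  = refuted (¬p ∘ g)
decides-map f g (confirmed p) = confirmed (f p)

decides-boolean : ∀ {P b} → Reflects P b → Decides P (boolean b)
decides-boolean (ofʸ p)  = confirmed p
decides-boolean (ofⁿ ¬p) = refuted ¬p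

decides-< : ∀ i j → Decides (i < j) (boolean (i <ᵇ j))
decides-< i j = decides-boolean (<ᵇ-reflects-< i j)

decides-≡ : ∀ i j → Decides (i ≡ j) (boolean (i ≡ᵇ j))
decides-≡ i j = decides-boolean (fromEquivalence (≡ᵇ⇒≡ i j) (≡⇒≡ᵇ i j))

decides-× : ∀ {P Q v w} → Decides P v → Decides Q w → Decides (P × Q) (v * w)
decides-× (refuted ¬p)          _            = refuted (¬p ∘ proj₁)
decides-× (confirmed p)         (confirmed q) = confirmed (p , q)
decides-× {v = v} (confirmed p) (refuted ¬q)
  = subst (Decides _) (sym (*-zeroʳ v)) (refuted (¬q ∘ proj₂))

decides-⊎ : ∀ {P Q v w} → Decides P v → Decides Q w → Decides (P ⊎ Q) (v + w)
decides-⊎ (confirmed p) _             = confirmed (inj₁ p)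
decides-⊎ (refuted ¬p)  (confirmed q) = confirmed (inj₂ q)
decides-⊎ (refuted ¬p)  (refuted ¬q)  = refuted Sum.[ ¬p , ¬q ]

when-rule : ∀ {P w} {τ ρ : Mem × ℕ} (R : Mem → Set) → Decides P w →
            (P → R (proj₁ τ)) → (¬ P → R (proj₁ ρ)) → R (proj₁ (if w ≡ᵇ 0 then ρ else τ))
when-rule R (refuted ¬p)  _ g = g ¬p
when-rule R (confirmed p) f _ = f p

loop-rule : (R : ℕ → Mem → Set) → ∀ r i f →
            (∀ j σ → i ≤ j → j < i + r → R j σ → R (suc j) (proj₁ (f j σ))) →
            ∀ σ → R i σ → R (i + r) (proj₁ (loop r i f σ))
loop-rule R zero    i f body σ init = subst (λ j → R j σ) (sym (+-identityʳ i)) init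
loop-rule R (suc r) i f body σ init =
  subst (λ j → R j (proj₁ (loop r (suc i) f (proj₁ (f i σ))))) (sym (+-suc i r))
    (loop-rule R r (suc i) f
      (λ j σ i<j j<end → body j σ (<⇒≤ i<j) (subst (j <_) (sym (+-suc i r)) j<end))
      _ (body i σ ≤-refl (m<m+n i (s≤s z≤n)) init))

for-rule : (R : ℕ → Mem → Set) → ∀ l h c σ → eval l σ ≤ eval h σ →
           (∀ j σ₁ → eval l σ ≤ j → j < eval h σ → R j σ₁ → R (suc j) (run (c j) σ₁)) →
           R (eval l σ) σ → R (eval h σ) (run (For l h c) σ)
for-rule R l h c σ l≤h body init =
  subst (λ j → R j (run (For l h c) σ)) (m+[n∸m]≡n l≤h)
    (loop-rule R _ (eval l σ) (exec ∘ c)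
      (λ j σ₁ l≤j j<end → body j σ₁ l≤j (subst (j <_) (m+[n∸m]≡n l≤h) j<end)) σ init)

-- Φ j is the amortised budget up to iteration j.
loop-steps : (R : ℕ → Mem → Set) (Φ : ℕ → ℕ) → ∀ r i f →
             (∀ j σ → i ≤ j → j < i + r → R j σ →
              R (suc j) (proj₁ (f j σ)) × Φ j + suc (proj₂ (f j σ)) ≤ Φ (suc j)) →
             ∀ σ → R i σ → Φ i + proj₂ (loop r i f σ) ≤ Φ (i + r)
loop-steps R Φ zero    i f body σ init = ≤-reflexive (trans (+-identityʳ (Φ i)) (cong Φ (sym (+-identityʳ i))))
loop-steps R Φ (suc r) i f body σ init = begin
  Φ i + suc (proj₂ (f i σ) + proj₂ (loop r (suc i) f (proj₁ (f i σ))))  ≡⟨ +-assoc (Φ i) (suc (proj₂ (f i σ))) _ ⟨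
  Φ i + suc (proj₂ (f i σ)) + proj₂ (loop r (suc i) f (proj₁ (f i σ)))  ≤⟨ +-monoˡ-≤ _ (proj₂ first) ⟩
  Φ (suc i) + proj₂ (loop r (suc i) f (proj₁ (f i σ)))                  ≤⟨ rest ⟩
  Φ (suc i + r)                                                         ≡⟨ cong Φ (+-suc i r) ⟨
  Φ (i + suc r)                                                         ∎
  where
  open ≤-Reasoning
  first = body i σ ≤-refl (m<m+n i (s≤s z≤n)) init
  rest  = loop-steps R Φ r (suc i) f
    (λ j σ i<j j<end → body j σ (<⇒≤ i<j) (subst (j <_) (sym (+-suc i r)) j<end))
    (proj₁ (f i σ)) (proj₁ first)

-- A record, so that unification recovers the command and the bound, and step counts are assembled
-- along the syntax. The bound is uniform in the memory; `placePath`, whose loop bounds are read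
-- from memory, has to be counted separately.
record Takes (c : Cmd ℕ) (t : ℕ) : Set where
  constructor takes
  field bound : ∀ σ → steps c σ ≤ t

open Takes public

takes-skip : Takes skip 1
takes-skip = takes λ _ → ≤-refl

takes-assign : ∀ {r i e} → Takes (r [ i ]≔ e) (suc (cost i + cost e))
takes-assign = takes λ _ → ≤-refl

takes-⨾ : ∀ {c d s t} → Takes c s → Takes d t → Takes (c ⨾ d) (s + t)
takes-⨾ p q = takes λ σ → +-mono-≤ (bound p σ) (bound q _)

takes-when : ∀ {b c d s t} → Takes c s → Takes d t → Takes (when b c d) (suc (cost b + (s ⊔ t)))
takes-when {b} {c} {d} {s} {t} p q = takes branch
  where
  branch : ∀ σ → steps (when b c d) σ ≤ suc (cost b + (s ⊔ t))
  branch σ with eval b σ ≡ᵇ 0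
  ... | true  = s≤s (+-monoʳ-≤ (cost b) (≤-trans (bound q σ) (m≤n⊔m s t)))
  ... | false = s≤s (+-monoʳ-≤ (cost b) (≤-trans (bound p σ) (m≤m⊔n s t)))

takes-Let : ∀ {e c t} → (∀ w → Takes (c w) t) → Takes (Let e c) (suc (cost e + t))
takes-Let {e} p = takes λ σ → s≤s (+-monoʳ-≤ (cost e) (bound (p _) σ))

steps-For : ∀ {l h c t} → (∀ i → Takes (c i) t) → ∀ σ →
            steps (For l h c) σ ≤ suc (cost l + cost h + (eval h σ ∸ eval l σ) * suc t)
steps-For {l} {h} {c} {t} p σ = s≤s (+-monoʳ-≤ (cost l + cost h) (iterate (eval h σ ∸ eval l σ) _ σ))
  where
  iterate : ∀ r i σ → proj₂ (loop r i (exec ∘ c) σ) ≤ r * suc t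
  iterate zero    i σ = z≤n
  iterate (suc r) i σ = s≤s (+-mono-≤ (bound (p i) σ) (iterate r (suc i) _))

takes-For : ∀ {w c t} → (∀ i → Takes (c i) t) → Takes (For (lit 0) (` w) c) (3 + w * suc t)
takes-For {w} p = takes (steps-For {lit 0} {` w} p)

-- A left inverse of `code` gives injectivity with one case per array instead of one per pair of
-- arrays.
decode : ℕ → Arr
decode 0 = start
decode 1 = vtx
decode 2 = srcs
decode 3 = tgts
decode 4 = topo
decode 5 = x
decode 6 = y
decode 7 = at
decode 8 = bentE
decode 9 = bendX
decode _ = bendY

decode-code : ∀ r → decode (code r) ≡ r
decode-code start = refl
decode-code vtx   = refl
decode-code srcs  = refl
decode-code tgts  = refl
decode-code topo  = refl
decode-code x     = refl
decode-code y     = refl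
decode-code at    = refl
decode-code bentE = refl
decode-code bendX = refl
decode-code bendY = refl

code-injective : ∀ {r s} → code r ≡ code s → r ≡ s
code-injective {r} {s} eq = trans (sym (decode-code r)) (trans (cong decode eq) (decode-code s))

≡ᵇ-refl : ∀ i → (i ≡ᵇ i) ≡ true
≡ᵇ-refl zero    = refl
≡ᵇ-refl (suc i) = ≡ᵇ-refl i

read-same : ∀ r i w σ → write r i w σ r i ≡ w
read-same r i w σ rewrite ≡ᵇ-refl (code r) | ≡ᵇ-refl i = refl

read-other : ∀ r i w σ s j → ¬ (r ≡ s × i ≡ j) → write r i w σ s j ≡ σ s j
read-other r i w σ s j ≢ with code r ≡ᵇ code s in p | i ≡ᵇ j in q
... | true  | true  = contradiction
  (code-injective (≡ᵇ⇒≡ (code r) (code s) (subst Bool.T (sym p) tt)) , ≡ᵇ⇒≡ i j (subst Bool.T (sym q) tt)) ≢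
... | true  | false = refl
... | false | _     = refl

-- W r i: the command may write to cell i of array r.
Confined : (Arr → ℕ → Set) → Cmd ℕ → Set
Confined W skip          = ⊤
Confined W (r [ i ]≔ t)  = ∀ σ → W r (eval i σ)
Confined W (c ⨾ d)       = Confined W c × Confined W d
Confined W (when t c d)  = Confined W c × Confined W d
Confined W (Let t c)     = ∀ w → Confined W (c w)
Confined W (For l h c)   = ∀ i → Confined W (c i)

frame : ∀ W c → Confined W c → ∀ σ {s j} → ¬ W s j → run c σ s j ≡ σ s j
frame W skip         _         σ ¬w = refl
frame W (r [ i ]≔ t) conf  σ {s} {j} ¬w =
  read-other r (eval i σ) (eval t σ) σ s j λ { (refl , refl) → ¬w (conf σ) }
frame W (c ⨾ d)      (p , q)   σ ¬w = trans (frame W d q _ ¬w) (frame W c p σ ¬w)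
frame W (when t c d) (p , q)   σ ¬w with eval t σ ≡ᵇ 0
... | true  = frame W d q σ ¬w
... | false = frame W c p σ ¬w
frame W (Let t c)    conf      σ ¬w = frame W (c (eval t σ)) (conf _) σ ¬w
frame W (For l h c)  conf      σ {s} {j} ¬w =
  loop-rule (λ _ σ₁ → σ₁ s j ≡ σ s j) (eval h σ ∸ eval l σ) (eval l σ) (exec ∘ c)
    (λ i σ₁ _ _ eq → trans (frame W (c i) (conf i) σ₁ ¬w) eq) σ refl

-- Correctness of the program

cells-∈ : ∀ ws {j} → j < length ws → cells ws j ∈ ws
cells-∈ (w ∷ ws) {zero}  _         = here refl
cells-∈ (w ∷ ws) {suc j} (s≤s j<) = there (cells-∈ ws j<)

∈-cells : ∀ {w ws} → w ∈ ws → ∃[ j ] (j < length ws × cells ws j ≡ w)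
∈-cells (here refl) = 0 , s≤s z≤n , refl
∈-cells (there w∈) with j , j< , eq ← ∈-cells w∈ = suc j , s≤s j< , eq

cells-++ˡ : ∀ vs {ws j} → j < length vs → cells (vs ++ ws) j ≡ cells vs j
cells-++ˡ (v ∷ vs) {j = zero}  _         = refl
cells-++ˡ (v ∷ vs) {j = suc j} (s≤s j<) = cells-++ˡ vs j<

cells-++ʳ : ∀ vs ws j → cells (vs ++ ws) (length vs + j) ≡ cells ws j
cells-++ʳ []       ws j = refl
cells-++ʳ (v ∷ vs) ws j = cells-++ʳ vs ws j

cells-tabulate : ∀ {n} (f : Fin n → ℕ) i → cells (tabulate f) (toℕ i) ≡ f i
cells-tabulate f Fin.zero    = refl
cells-tabulate f (Fin.suc i) = cells-tabulate (f ∘ Fin.suc) i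

concat-take-suc : ∀ {A : Set} {k} (f : Fin k → List A) i →
                  concat (take (suc (toℕ i)) (tabulate f)) ≡ concat (take (toℕ i) (tabulate f)) ++ f i
concat-take-suc f i = begin
  concat (take (suc (toℕ i)) (tabulate f))               ≡⟨ cong concat (take-suc-tabulate f i) ⟩
  concat (take (toℕ i) (tabulate f) ++ f i ∷ [])         ≡⟨ concat-++ (take (toℕ i) (tabulate f)) (f i ∷ []) ⟨
  concat (take (toℕ i) (tabulate f)) ++ f i ++ []        ≡⟨ cong (concat (take (toℕ i) (tabulate f)) ++_) (++-identityʳ (f i)) ⟩
  concat (take (toℕ i) (tabulate f)) ++ f i              ∎
  where open ≡-Reasoning

concat-split : ∀ {A : Set} {k} (f : Fin k → List A) i →
               concat (tabulate f) ≡ concat (take (toℕ i) (tabulate f)) ++ f i ++ concat (drop (suc (toℕ i)) (tabulate f))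
concat-split f i = begin
  concat (tabulate f)                                                 ≡⟨ cong concat (take++drop≡id (suc (toℕ i)) (tabulate f)) ⟨
  concat (take (suc (toℕ i)) (tabulate f) ++ rest)                    ≡⟨ concat-++ (take (suc (toℕ i)) (tabulate f)) rest ⟨
  concat (take (suc (toℕ i)) (tabulate f)) ++ concat rest             ≡⟨ cong (_++ concat rest) (concat-take-suc f i) ⟩
  (concat (take (toℕ i) (tabulate f)) ++ f i) ++ concat rest          ≡⟨ ++-assoc (concat (take (toℕ i) (tabulate f))) (f i) _ ⟩
  concat (take (toℕ i) (tabulate f)) ++ f i ++ concat rest            ∎
  where
  open ≡-Reasoning
  rest = drop (suc (toℕ i)) (tabulate f)

div-exact : ∀ h {q} → q > 0 → (h * q) div q ≡ h
div-exact h {suc q} _ = m*n/n≡m h (suc q)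

module Execution (I : Input) where
  open Input I

  pathOf : Fin n → Fin k
  pathOf v = proj₁ (covers S v)

  pathOf-unique : ∀ {i v} → v ∈ path S i → pathOf v ≡ i
  pathOf-unique {v = v} v∈ = disjoint S (proj₂ (covers S v)) v∈

  column : Fin n → ℕ
  column v = 2 * suc (toℕ (pathOf v))

  column-injective : ∀ {v i} → column v ≡ 2 * suc (toℕ i) → pathOf v ≡ i
  column-injective eq = toℕ-injective (suc-injective (*-cancelˡ-≡ _ _ 2 eq))

  T-injective : ∀ {u v} → T u ≡ T v → u ≡ v
  T-injective {u} {v} eq = begin
    u                            ≡⟨ inverseˡ τ ⟨
    τ ⟨$⟩ˡ (τ ⟨$⟩ʳ u)            ≡⟨ cong (τ ⟨$⟩ˡ_) (toℕ-injective (suc-injective eq)) ⟩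
    τ ⟨$⟩ˡ (τ ⟨$⟩ʳ v)            ≡⟨ inverseˡ τ ⟩
    v                            ∎
    where open ≡-Reasoning

  T≤n : ∀ v → T v ≤ n
  T≤n v = toℕ<n (τ ⟨$⟩ʳ v)

  T-surjective : ∀ {j} → j < n → ∃[ v ] T v ≡ suc j
  T-surjective {j} j<n = τ ⟨$⟩ˡ fromℕ< j<n ,
    cong suc (trans (cong toℕ (inverseʳ τ)) (toℕ-fromℕ< j<n))

  edge-T : ∀ e → T (src H e) < T (tgt H e)
  edge-T e = s≤s (isTopo _ _ (proj₁ (Equivalence.to (isPDG _ _) (e , refl))))

  starts : ℕ → ℕ
  starts = memory I start

  vertices : ℕ → ℕ
  vertices = memory I vtx

  starts-suc : ∀ i → starts (suc (toℕ i)) ≡ starts (toℕ i) + length (path S i)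
  starts-suc i = trans (cong length (concat-take-suc (path S) i))
    (length-++ (concat (take (toℕ i) (tabulate (path S)))))

  starts-k : starts k ≡ length (concat (tabulate (path S)))
  starts-k = cong (length ∘ concat) (take-all k _ (≤-reflexive (length-tabulate (path S))))

  -- Cutting the concatenation of all paths before and after path `i` turns the global cell number
  -- into an offset within that path.
  vertices-path : ∀ i {j} → starts (toℕ i) ≤ j → j < starts (suc (toℕ i)) →
                  ∃[ v ] (v ∈ path S i × vertices j ≡ toℕ v)
  vertices-path i {j} start≤j j<end
    with o , refl ← m≤n⇒∃[o]m+o≡n start≤j = found (∈-map⁻ toℕ (cells-∈ (map toℕ (path S i)) o<))
    where
    before = concat (take (toℕ i) (tabulate (path S)))
    after  = concat (drop (suc (toℕ i)) (tabulate (path S)))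

    o< : o < length (map toℕ (path S i))
    o< = subst (o <_) (sym (length-map toℕ (path S i)))
      (+-cancelˡ-< (starts (toℕ i)) o _ (subst (starts (toℕ i) + o <_) (starts-suc i) j<end))

    open ≡-Reasoning
    cell : vertices (starts (toℕ i) + o) ≡ cells (map toℕ (path S i)) o
    cell = begin
      cells (map toℕ (concat (tabulate (path S)))) (length before + o)
        ≡⟨ cong (λ vs → cells (map toℕ vs) (length before + o)) (concat-split (path S) i) ⟩
      cells (map toℕ (before ++ path S i ++ after)) (length before + o)
        ≡⟨ cong₂ cells (map-++ toℕ before _) (cong (_+ o) (sym (length-map toℕ before))) ⟩
      cells (map toℕ before ++ map toℕ (path S i ++ after)) (length (map toℕ before) + o)
        ≡⟨ cells-++ʳ (map toℕ before) _ o ⟩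
      cells (map toℕ (path S i ++ after)) o
        ≡⟨ cong (λ vs → cells vs o) (map-++ toℕ (path S i) after) ⟩
      cells (map toℕ (path S i) ++ map toℕ after) o
        ≡⟨ cells-++ˡ (map toℕ (path S i)) o< ⟩
      cells (map toℕ (path S i)) o ∎

    found : ∃[ v ] (v ∈ path S i × cells (map toℕ (path S i)) o ≡ toℕ v) → _
    found (v , v∈ , eq) = v , v∈ , trans cell eq

  vertices-onto : ∀ v → ∃[ j ] (j < starts k × vertices j ≡ toℕ v)
  vertices-onto v
    with j , j< , eq ← ∈-cells (∈-map⁺ toℕ (∈-concat⁺′ (proj₂ (covers S v)) (∈-tabulate⁺ (pathOf v))))
    = j , subst (j <_) (trans (length-map toℕ (concat (tabulate (path S)))) (sym starts-k)) j< , eq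

  -- Placement of the vertices

  placeVertex : ℕ → ℕ → Cmd ℕ
  placeVertex i j = x [ vtx [ ` j ] ]≔ lit 2 ⊗ (` i ⊕ lit 1)

  placePath : ℕ → Cmd ℕ
  placePath i = for j from start [ ` i ] below start [ ` i ⊕ lit 1 ] do′ placeVertex i j

  placeColumns : Cmd ℕ
  placeColumns = for i from lit 0 below ` k do′ placePath i

  placeRow : ℕ → Cmd ℕ
  placeRow v = y [ ` v ]≔ topo [ ` v ] ⨾ at [ topo [ ` v ] ]≔ ` v

  placeRows : Cmd ℕ
  placeRows = for v from lit 0 below ` n do′ placeRow v

  -- Progress is measured in cells of `vtx` across all paths, so that one invariant serves both
  -- nested loops: the inner one at `j`, the outer one at `starts i`. The first clause lets the
  -- words of `start` and `vtx` that are read on the way be replaced by their initial values.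
  Columns : ℕ → Mem → Set
  Columns j σ = (∀ {r i} → r ≢ x → σ r i ≡ memory I r i) ×
    (∀ {j′} v → j′ < j → vertices j′ ≡ toℕ v → σ x (toℕ v) ≡ column v)

  placePath-columns : ∀ i {σ} → Columns (starts (toℕ i)) σ →
                      Columns (starts (suc (toℕ i))) (run (placePath (toℕ i)) σ)
  placePath-columns i {σ} init@(keeps , _) = subst (λ j → Columns j (run (placePath (toℕ i)) σ)) end
    (for-rule Columns (start [ ` toℕ i ]) (start [ ` toℕ i ⊕ lit 1 ]) (placeVertex (toℕ i)) σ
      (subst₂ _≤_ (sym begin′) (sym (trans end (starts-suc i))) (m≤m+n _ _))
      body (subst (λ j → Columns j σ) (sym begin′) init))
    where
    begin′ : σ start (toℕ i) ≡ starts (toℕ i)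
    begin′ = keeps λ ()
    end : σ start (toℕ i + 1) ≡ starts (suc (toℕ i))
    end = trans (keeps λ ()) (cong starts (+-comm (toℕ i) 1))

    body : ∀ j σ₁ → σ start (toℕ i) ≤ j → j < σ start (toℕ i + 1) →
           Columns j σ₁ → Columns (suc j) (run (placeVertex (toℕ i) j) σ₁)
    body j σ₁ ≤j j< (keeps₁ , done)
      with w , w∈ , vtx-j ← vertices-path i (subst (_≤ j) begin′ ≤j) (subst (j <_) end j<)
      = (λ r≢x → trans (read-other x (σ₁ vtx j) (2 * (toℕ i + 1)) σ₁ _ _ λ { (refl , _) → r≢x refl }) (keeps₁ r≢x))
      , λ { v (s≤s j′≤j) vtx-j′ → placed v (m≤n⇒m<n∨m≡n j′≤j) vtx-j′ }
      where
      index : σ₁ vtx j ≡ toℕ w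
      index = trans (keeps₁ λ ()) vtx-j

      value : 2 * (toℕ i + 1) ≡ column w
      value = cong (2 *_) (trans (+-comm (toℕ i) 1) (cong (suc ∘ toℕ) (sym (pathOf-unique w∈))))

      placed-w : run (placeVertex (toℕ i) j) σ₁ x (toℕ w) ≡ column w
      placed-w = trans (cong (λ z → write x z (2 * (toℕ i + 1)) σ₁ x (toℕ w)) index)
        (trans (read-same x (toℕ w) _ σ₁) value)

      placed : ∀ v {j′} → j′ < j ⊎ j′ ≡ j → vertices j′ ≡ toℕ v →
               run (placeVertex (toℕ i) j) σ₁ x (toℕ v) ≡ column v
      placed v j′≤j vtx-j′ with v ≟ w
      placed v _            _      | yes refl = placed-w
      placed v (inj₁ j′<j) vtx-j′ | no v≢w  =
        trans (read-other x (σ₁ vtx j) (2 * (toℕ i + 1)) σ₁ x (toℕ v) λ (_ , eq) → v≢w (toℕ-injective (trans (sym eq) index)))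
              (done v j′<j vtx-j′)
      placed v (inj₂ refl)  vtx-j′ | no v≢w  =
        contradiction (toℕ-injective (trans (sym vtx-j′) vtx-j)) v≢w

  fromℕ<-elim : ∀ {N} (R : ℕ → Set) → (∀ (i : Fin N) → R (toℕ i)) → ∀ {j} → j < N → R j
  fromℕ<-elim R r j<N = subst R (toℕ-fromℕ< j<N) (r (fromℕ< j<N))

  columns-placed : Columns (starts k) (run placeColumns (memory I))
  columns-placed = for-rule (λ i → Columns (starts i)) (lit 0) (` k) placePath (memory I) z≤n
    (λ i σ _ i<k → fromℕ<-elim
      (λ i → Columns (starts i) σ → Columns (starts (suc i)) (run (placePath i) σ))
      (λ i → placePath-columns i) i<k)
    ((λ _ → refl) , λ _ ())

  Rows : Mem → ℕ → Mem → Set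
  Rows σ₀ j σ = (∀ {r i} → r ≢ y → r ≢ at → σ r i ≡ σ₀ r i) ×
    (∀ v → toℕ v < j → σ y (toℕ v) ≡ T v × σ at (T v) ≡ toℕ v)

  placeRow-rows : ∀ {σ₀} → (∀ v → σ₀ topo (toℕ v) ≡ T v) → ∀ w {σ} →
                  Rows σ₀ (toℕ w) σ → Rows σ₀ (suc (toℕ w)) (run (placeRow (toℕ w)) σ)
  placeRow-rows {σ₀} order w {σ} (keeps , done) =
    (λ r≢y r≢at → trans (unchanged (r≢y ∘ proj₁) (r≢at ∘ proj₁)) (keeps r≢y r≢at)) ,
    λ { v (s≤s v≤w) → placed v (m≤n⇒m<n∨m≡n v≤w) }
    where
    σ₁ = write y (toℕ w) (σ topo (toℕ w)) σ
    σ₂ = write at (σ topo (toℕ w)) (toℕ w) σ₁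

    position : σ topo (toℕ w) ≡ T w
    position = trans (keeps (λ ()) λ ()) (order w)

    unchanged : ∀ {r i} → ¬ (r ≡ y × i ≡ toℕ w) → ¬ (r ≡ at × i ≡ σ topo (toℕ w)) → σ₂ r i ≡ σ r i
    unchanged {r} {i} ¬y ¬at =
      trans (read-other at (σ topo (toℕ w)) (toℕ w) σ₁ r i (λ (p , q) → ¬at (sym p , sym q)))
            (read-other y (toℕ w) (σ topo (toℕ w)) σ r i (λ (p , q) → ¬y (sym p , sym q)))

    placed : ∀ v → toℕ v < toℕ w ⊎ toℕ v ≡ toℕ w → σ₂ y (toℕ v) ≡ T v × σ₂ at (T v) ≡ toℕ v
    placed v (inj₁ v<w) =
      trans (unchanged (λ (_ , eq) → <⇒≢ v<w eq) λ ()) (proj₁ (done v v<w)) ,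
      trans (unchanged (λ ()) λ (_ , eq) → <⇒≢ v<w (cong toℕ (T-injective (trans eq position))))
            (proj₂ (done v v<w))
    placed v (inj₂ eq) with refl ← toℕ-injective eq =
      trans (trans (read-other at (σ topo (toℕ w)) (toℕ w) σ₁ y (toℕ w) λ ()) (read-same y (toℕ w) _ σ)) position ,
      subst (λ z → write at z (toℕ w) σ₁ at (T w) ≡ toℕ w) (sym position) (read-same at (T w) (toℕ w) σ₁)

  -- Everything that edge routing reads about vertices and edges. It resides in arrays outside
  -- `IsOutput`, hence survives all writes made while routing.
  record Layout (σ : Mem) : Set where
    field
      column-x : ∀ v → σ x (toℕ v) ≡ column v
      row-y    : ∀ v → σ y (toℕ v) ≡ T v
      row-at   : ∀ v → σ at (T v) ≡ toℕ v
      edge-src : ∀ e → σ srcs (toℕ e) ≡ toℕ (src H e)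
      edge-tgt : ∀ e → σ tgts (toℕ e) ≡ toℕ (tgt H e)

  open Layout

  layout : Layout (run (placeVertices n k) (memory I))
  layout = record
    { column-x = λ v → trans (keeps (λ ()) λ ()) (x-placed v)
    ; row-y    = λ v → proj₁ (done v (toℕ<n v))
    ; row-at   = λ v → proj₂ (done v (toℕ<n v))
    ; edge-src = λ e → trans (keeps (λ ()) λ ()) (trans (proj₁ columns-placed λ ()) (cells-tabulate _ e))
    ; edge-tgt = λ e → trans (keeps (λ ()) λ ()) (trans (proj₁ columns-placed λ ()) (cells-tabulate _ e))
    }
    where
    σ₀ = run placeColumns (memory I)

    x-placed : ∀ v → σ₀ x (toℕ v) ≡ column v
    x-placed v with j , j< , vtx-j ← vertices-onto v = proj₂ columns-placed v j< vtx-j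

    rows : Rows σ₀ n (run placeRows σ₀)
    rows = for-rule (Rows σ₀) (lit 0) (` n) placeRow σ₀ z≤n
      (λ j σ _ j<n → fromℕ<-elim
        (λ j → Rows σ₀ j σ → Rows σ₀ (suc j) (run (placeRow j) σ))
        (λ w → placeRow-rows (λ v → trans (proj₁ columns-placed λ ()) (cells-tabulate T v)) w) j<n)
      ((λ _ _ → refl) , λ _ ())

    keeps = proj₁ rows
    done  = proj₂ rows

  -- Detection and routing of blocked edges

  data IsOutput : Arr → Set where
    is-bentE : IsOutput bentE
    is-bendX : IsOutput bendX
    is-bendY : IsOutput bendY

  layout-frame : ∀ {σ σ′} → (∀ {r i} → ¬ IsOutput r → σ′ r i ≡ σ r i) → Layout σ → Layout σ′
  layout-frame same L = record
    { column-x = λ v → trans (same λ ()) (column-x L v)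
    ; row-y    = λ v → trans (same λ ()) (row-y L v)
    ; row-at   = λ v → trans (same λ ()) (row-at L v)
    ; edge-src = λ e → trans (same λ ()) (edge-src L e)
    ; edge-tgt = λ e → trans (same λ ()) (edge-tgt L e)
    }

  -- The clause `T u ≤ T w` makes the truncated difference in `Meets` the true rise; without it, a
  -- vertex below `u` would be treated as if it had rise 0.
  Crosses : Fin n → Fin n → Fin n → Set
  Crosses u v w = Between (column u) (column w) (column v) × T u ≤ T w
                × Meets (column u) (column v) (T u) (T v) (column w) (T w ∸ T u)

  Crossed : Fin n → Fin n → Set
  Crossed u v = ∃[ w ] Crosses u v w

  -- The inner test of testColumn, with p and q the numerator and the
  -- denominator of the rise from row b to the column c.
  Hit : Mem → (c b p q : ℕ) → Set
  Hit σ c b p q = ((p div q) * q ≡ p) × (σ x (σ at (b + p div q)) ≡ c)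

  decides-hit : ∀ σ c b p q → Decides (Hit σ c b p q)
    (boolean ((p div q) * q ≡ᵇ p) * boolean (σ x (σ at (b + p div q)) ≡ᵇ c))
  decides-hit σ c b p q = decides-× (decides-≡ _ _) (decides-≡ _ _)

  module _ {σ} (L : Layout σ) {u v} (u<v : T u < T v) (i : Fin k) where

    private
      c = 2 * suc (toℕ i)
      p = ∣ c - column u ∣ * (T v ∸ T u)
      q = ∣ column v - column u ∣

    hit⇒crosses : Between (column u) c (column v) → Hit σ c (T u) p q →
                  ∃[ w ] (pathOf w ≡ i × Crosses u v w)
    -- By `meets-<` the computed row lies below `T v`, hence within the `n` rows, so some vertex
    -- occupies it and `at` returns that vertex rather than an initial 0.
    hit⇒crosses between (exact , at-c) = found (T-surjective (<-trans (n<1+n _) (<-≤-trans (meets-< u<v between exact) (T≤n v))))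
      where
      found : ∃[ w ] T w ≡ suc (toℕ (τ ⟨$⟩ʳ u) + p div q) → _
      found (w , T-w) = w , on-i , subst (λ z → Between (column u) z (column v)) (sym column-w) between
        , subst (T u ≤_) (sym T-w) (m≤m+n (T u) (p div q))
        , subst₂ (λ h z → Meets (column u) (column v) (T u) (T v) z h)
            (trans (sym (m+n∸m≡n (T u) (p div q))) (cong (_∸ T u) (sym T-w))) (sym column-w) exact
        where
        column-w : column w ≡ c
        column-w = trans (sym (column-x L w)) (trans (cong (σ x) (trans (sym (row-at L w)) (cong (σ at) T-w))) at-c)

        on-i : pathOf w ≡ i
        on-i = column-injective column-w

    crosses⇒hit : ∀ {w} → pathOf w ≡ i → Crosses u v w →
                  Between (column u) c (column v) × Hit σ c (T u) p q
    crosses⇒hit {w} refl (between , u≤w , meets) = between ,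
      subst (λ h → h * q ≡ p) (sym rise) meets ,
      trans (cong (λ h → σ x (σ at (T u + h))) rise)
        (trans (cong (σ x) (trans (cong (σ at) (m+[n∸m]≡n u≤w)) (row-at L w))) (column-x L w))
      where
      -- `_div_` returns 0 for a zero divisor; strict betweenness rules this case out.
      q>0 : q > 0
      q>0 = ≤-<-trans z≤n (between-distance between)

      rise : p div q ≡ T w ∸ T u
      rise = trans (cong (_div q) (sym meets)) (div-exact (T w ∸ T u) q>0)

  -- `B` stands for what the columns scanned earlier have established. A hit sets the flag to 1 and
  -- a miss leaves it alone, which amounts to a disjunction with `B`.
  testColumn-decides : ∀ {σ B} e {u v} i → Layout σ → T u < T v → Decides B (σ bentE e) →
    Decides (B ⊎ ∃[ w ] (pathOf w ≡ i × Crosses u v w))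
            (run (testColumn e (toℕ u) (toℕ v) (2 * (toℕ i + 1))) σ bentE e)
  testColumn-decides {σ} {B} e {u} {v} i L u<v before
    rewrite +-comm (toℕ i) 1 =
    when-rule R
      (decides-⊎ (decides-× (decides-< (σ x (toℕ u)) c) (decides-< c (σ x (toℕ v))))
                 (decides-× (decides-< (σ x (toℕ v)) c) (decides-< c (σ x (toℕ u)))))
      (λ between → when-rule R (decides-hit σ c (σ y (toℕ u)) p q)
        (λ hit → subst (Decides _) (sym (read-same bentE e 1 σ))
          (confirmed (inj₂ (hit⇒crosses L u<v i (between-layout between) (hit-layout hit)))))
        (λ ¬hit → decides-map inj₁
          Sum.[ (λ b → b) , (λ (w , on-i , cr) →
            contradiction (layout-hit (proj₂ (crosses⇒hit L u<v i on-i cr))) ¬hit) ] before))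
      (λ ¬between → decides-map inj₁
        Sum.[ (λ b → b) , (λ (w , on-i , cr) →
          contradiction (layout-between (proj₁ (crosses⇒hit L u<v i on-i cr))) ¬between) ] before)
    where
    c = 2 * suc (toℕ i)
    p = ((c ∸ σ x (toℕ u)) + (σ x (toℕ u) ∸ c)) * (σ y (toℕ v) ∸ σ y (toℕ u))
    q = (σ x (toℕ v) ∸ σ x (toℕ u)) + (σ x (toℕ u) ∸ σ x (toℕ v))

    R : Mem → Set
    R σ′ = Decides (B ⊎ ∃[ w ] (pathOf w ≡ i × Crosses u v w)) (σ′ bentE e)

    between-layout : Between (σ x (toℕ u)) c (σ x (toℕ v)) → Between (column u) c (column v)
    between-layout = subst₂ (λ a b → Between a c b) (column-x L u) (column-x L v)

    layout-between : Between (column u) c (column v) → Between (σ x (toℕ u)) c (σ x (toℕ v))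
    layout-between = subst₂ (λ a b → Between a c b) (sym (column-x L u)) (sym (column-x L v))

    p≡ : p ≡ ∣ c - column u ∣ * (T v ∸ T u)
    p≡ = trans (cong₂ (λ a d → ((c ∸ a) + (a ∸ c)) * d) (column-x L u) (cong₂ _∸_ (row-y L v) (row-y L u)))
               (cong (_* (T v ∸ T u)) (sym (∣m-n∣≡m∸n+n∸m c (column u))))

    q≡ : q ≡ ∣ column v - column u ∣
    q≡ = trans (cong₂ (λ a b → (b ∸ a) + (a ∸ b)) (column-x L u) (column-x L v))
               (sym (∣m-n∣≡m∸n+n∸m (column v) (column u)))

    hit≡ : Hit σ c (σ y (toℕ u)) p q ≡ Hit σ c (T u) (∣ c - column u ∣ * (T v ∸ T u)) ∣ column v - column u ∣
    hit≡ = trans (cong (λ b → Hit σ c b p q) (row-y L u)) (cong₂ (Hit σ c (T u)) p≡ q≡)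

    hit-layout = subst (λ A → A) hit≡
    layout-hit = subst (λ A → A) (sym hit≡)

  scanColumn : ℕ → ℕ → ℕ → ℕ → Cmd ℕ
  scanColumn e u v i = set c to lit 2 ⊗ (` i ⊕ lit 1) then testColumn e u v c

  scanColumns : ℕ → ℕ → ℕ → Cmd ℕ
  scanColumns e u v = for i from lit 0 below ` k do′ scanColumn e u v i

  routeEdgeFrom : ℕ → ℕ → ℕ → Cmd ℕ
  routeEdgeFrom e u v =
    bentE [ ` e ]≔ lit 0 ⨾ scanColumns e u v ⨾ (when bentE [ ` e ] then placeBend e u v otherwise skip)

  routeEdge : ℕ → Cmd ℕ
  routeEdge e = set u to srcs [ ` e ] then set v to tgts [ ` e ] then routeEdgeFrom e u v

  Slot : ℕ → Arr → ℕ → Set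
  Slot e r i = IsOutput r × i ≡ e

  testColumn-confined : ∀ e u v c → Confined (Slot e) (testColumn e u v c)
  testColumn-confined e u v c = (λ _ _ _ → (λ _ → is-bentE , refl) , tt) , tt

  placeBend-confined : ∀ e u v → Confined (Slot e) (placeBend e u v)
  placeBend-confined e u v = ((λ _ → is-bendX , refl) , (λ _ → is-bendX , refl)) , (λ _ → is-bendY , refl)

  routeEdge-confined : ∀ e → Confined (Slot e) (routeEdge e)
  routeEdge-confined e u v = (λ _ → is-bentE , refl) , (λ i c → testColumn-confined e u v c) ,
    placeBend-confined e u v , tt

  -- The invariant `Scanned` looks for a blocking vertex only on the paths scanned so far; at `k`
  -- this restriction is void, since every vertex lies on some path.
  scanColumns-decides : ∀ {σ} e {u v} → T u < T v → Layout σ → σ bentE e ≡ 0 →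
    Decides (Crossed u v) (run (scanColumns e (toℕ u) (toℕ v)) σ bentE e)
      × Layout (run (scanColumns e (toℕ u) (toℕ v)) σ)
  scanColumns-decides {σ} e {u} {v} u<v L zero-e =
    decides-map (λ (w , _ , cr) → w , cr) (λ (w , cr) → w , toℕ<n (pathOf w) , cr) (proj₁ scanned) , proj₂ scanned
    where
    Scanned : ℕ → Mem → Set
    Scanned i σ = Decides (∃[ w ] (toℕ (pathOf w) < i × Crosses u v w)) (σ bentE e) × Layout σ

    scan : ∀ (i : Fin k) {σ} → Scanned (toℕ i) σ → Scanned (suc (toℕ i)) (run (scanColumn e (toℕ u) (toℕ v) (toℕ i)) σ)
    scan i {σ} (decides , L) =
      decides-map
        Sum.[ (λ (w , w<i , cr) → w , m≤n⇒m≤1+n w<i , cr) , (λ { (w , refl , cr) → w , ≤-refl , cr }) ]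
        (λ { (w , s≤s w≤i , cr) → Sum.map (λ w<i → w , w<i , cr) (λ eq → w , toℕ-injective eq , cr) (m≤n⇒m<n∨m≡n w≤i) })
        (testColumn-decides e i L u<v decides) ,
      layout-frame (λ ¬out → frame (Slot e) (testColumn e (toℕ u) (toℕ v) (2 * (toℕ i + 1))) (testColumn-confined e (toℕ u) (toℕ v) (2 * (toℕ i + 1))) σ (¬out ∘ proj₁)) L

    scanned : Scanned k (run (scanColumns e (toℕ u) (toℕ v)) σ)
    scanned = for-rule Scanned (lit 0) (` k) (scanColumn e (toℕ u) (toℕ v)) σ z≤n
      (λ i σ _ i<k → fromℕ<-elim
        (λ i → Scanned i σ → Scanned (suc i) (run (scanColumn e (toℕ u) (toℕ v) i) σ))
        (λ i → scan i) i<k)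
      (subst (Decides _) (sym zero-e) (refuted λ ()) , L)

  -- The counterpart of `IsBend` in ℕ. Columns are at least 2 and rows at least 1, so truncated
  -- subtraction of 1 agrees by computation with subtraction in ℤ.
  record Bend (u v : Fin n) (bx by : ℕ) : Set where
    field
      rightward : column u < column v → bx ≡ column u + 1
      leftward  : ¬ column u < column v → bx ≡ column u ∸ 1
      below     : by ≡ T v ∸ 1

  Routed : Fin a → Mem → Set
  Routed e σ = Decides (Crossed (src H e) (tgt H e)) (σ bentE (toℕ e))
    × (Crossed (src H e) (tgt H e) → Bend (src H e) (tgt H e) (σ bendX (toℕ e)) (σ bendY (toℕ e)))

  placeBend-bend : ∀ {σ} e {u v} → Layout σ →
    let σ′ = run (placeBend e (toℕ u) (toℕ v)) σ in
    Bend u v (σ′ bendX e) (σ′ bendY e) × σ′ bentE e ≡ σ bentE e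
  placeBend-bend {σ} e {u} {v} L = record
    { rightward = proj₁ bx
    ; leftward  = proj₂ bx
    ; below     = trans (read-same bendY e _ σ₁) (cong (_∸ 1) (trans (frame (λ r _ → r ≡ bendX) setX confX σ {y} {toℕ v} (λ ())) (row-y L v)))
    } , frame (λ r _ → r ≢ bentE) (placeBend e (toℕ u) (toℕ v)) (((λ _ ()) , (λ _ ())) , (λ _ ())) σ (λ ≢ → ≢ refl)
    where
    setX : Cmd ℕ
    setX = when x [ ` toℕ u ] ≺ x [ ` toℕ v ]
           then bendX [ ` e ]≔ x [ ` toℕ u ] ⊕ lit 1
           otherwise (bendX [ ` e ]≔ x [ ` toℕ u ] ⊖ lit 1)

    confX : Confined (λ r _ → r ≡ bendX) setX
    confX = (λ _ → refl) , (λ _ → refl)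

    σ₁ = run setX σ

    Placed : Mem → Set
    Placed σ′ = (column u < column v → σ′ bendX e ≡ column u + 1) × (¬ column u < column v → σ′ bendX e ≡ column u ∸ 1)

    placed : Placed σ₁
    placed = when-rule Placed
      (subst₂ (λ a b → Decides (a < b) (boolean (σ x (toℕ u) <ᵇ σ x (toℕ v)))) (column-x L u) (column-x L v)
        (decides-< (σ x (toℕ u)) (σ x (toℕ v))))
      (λ u<v → (λ _ → trans (read-same bendX e _ σ) (cong (_+ 1) (column-x L u))) , (λ u≮v → contradiction u<v u≮v))
      (λ u≮v → (λ u<v → contradiction u<v u≮v) , (λ _ → trans (read-same bendX e _ σ) (cong (_∸ 1) (column-x L u))))

    bx : Placed (write bendY e (σ₁ y (toℕ v) ∸ 1) σ₁)
    bx = (λ u<v → trans (kept bendY) (proj₁ placed u<v)) , (λ u≮v → trans (kept bendY) (proj₂ placed u≮v))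
      where
      kept : ∀ r → write bendY e (σ₁ y (toℕ v) ∸ 1) σ₁ bendX e ≡ σ₁ bendX e
      kept _ = read-other bendY e (σ₁ y (toℕ v) ∸ 1) σ₁ bendX e λ ()

  routeEdge-routed : ∀ {σ} e → Layout σ → Routed e (run (routeEdge (toℕ e)) σ)
  routeEdge-routed {σ} e L =
    subst₂ (λ u v → Routed e (run (routeEdgeFrom (toℕ e) u v) σ)) (sym (edge-src L e)) (sym (edge-tgt L e))
      (when-rule (Routed e) crossed
        (λ cr → (subst (Decides _) (sym (proj₂ bent)) crossed) , λ _ → proj₁ bent)
        (λ ¬cr → crossed , λ cr → contradiction cr ¬cr))
    where
    u = src H e
    v = tgt H e
    σ₁ = write bentE (toℕ e) 0 σ
    σ₂ = run (scanColumns (toℕ e) (toℕ u) (toℕ v)) σ₁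

    L₁ : Layout σ₁
    L₁ = layout-frame (λ {r} {i} ¬out → read-other bentE (toℕ e) 0 σ r i λ { (refl , _) → ¬out is-bentE }) L

    scanned = scanColumns-decides (toℕ e) (edge-T e) L₁ (read-same bentE (toℕ e) 0 σ)
    crossed = proj₁ scanned
    bent    = placeBend-bend (toℕ e) {u} {v} (proj₂ scanned)

  AllRouted : ℕ → Mem → Set
  AllRouted j σ = Layout σ × (∀ e → toℕ e < j → Routed e σ)

  final : Mem
  final = proj₁ (result I)

  all-routed : AllRouted a final
  all-routed = for-rule AllRouted (lit 0) (` a) routeEdge _ z≤n
    (λ j σ _ j<a → fromℕ<-elim (λ j → AllRouted j σ → AllRouted (suc j) (run (routeEdge j) σ)) (λ e → route e) j<a)
    (layout , λ _ ())
    where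
    route : ∀ (e : Fin a) {σ} → AllRouted (toℕ e) σ → AllRouted (suc (toℕ e)) (run (routeEdge (toℕ e)) σ)
    route e {σ} (L , done) =
      layout-frame (λ ¬out → unchanged (¬out ∘ proj₁)) L ,
      λ { e′ (s≤s e′≤e) → routed e′ (m≤n⇒m<n∨m≡n e′≤e) }
      where
      unchanged : ∀ {r i} → ¬ Slot (toℕ e) r i → run (routeEdge (toℕ e)) σ r i ≡ σ r i
      unchanged = frame (Slot (toℕ e)) (routeEdge (toℕ e)) (routeEdge-confined (toℕ e)) σ

      routed : ∀ e′ → toℕ e′ < toℕ e ⊎ toℕ e′ ≡ toℕ e → Routed e′ (run (routeEdge (toℕ e)) σ)
      routed e′ (inj₂ eq) with refl ← toℕ-injective eq = routeEdge-routed e L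
      routed e′ (inj₁ e′<e) =
        subst (Decides _) (sym (unchanged outside)) (proj₁ (done e′ e′<e)) ,
        λ cr → subst₂ (Bend _ _) (sym (unchanged outside)) (sym (unchanged outside)) (proj₂ (done e′ e′<e) cr)
        where
        outside : ∀ {r} → ¬ Slot (toℕ e) r (toℕ e′)
        outside (_ , eq) = <⇒≢ e′<e eq

  -- Geometry of the drawing

  data Traced (u v : Fin n) : List Point → Set where
    straight : ¬ Crossed u v → Traced u v []
    bent     : ∀ {bx by} → Crossed u v → Bend u v bx by → Traced u v ((+ bx , + by) ∷ [])

  pos-drawing : ∀ v → pos (drawing I) v ≡ (+ column v , + T v)
  pos-drawing v = cong₂ (λ i j → + i , + j) (column-x (proj₁ all-routed) v) (row-y (proj₁ all-routed) v)

  bends-drawing : ∀ e → Traced (src H e) (tgt H e) (bends (drawing I) e)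
  bends-drawing e = trace (proj₁ routed) (proj₂ routed)
    where
    routed = proj₂ all-routed e (toℕ<n e)

    trace : ∀ {w bx by} → Decides (Crossed (src H e) (tgt H e)) w →
            (Crossed (src H e) (tgt H e) → Bend (src H e) (tgt H e) bx by) →
            Traced (src H e) (tgt H e) (if w ≡ᵇ 0 then [] else (+ bx , + by) ∷ [])
    trace (refuted ¬cr)  _    = straight ¬cr
    trace (confirmed cr) bend = bent cr (bend cr)

  -- The drawing is a variable here: its positions are neutral terms that can be rewritten, and the
  -- geometry never unfolds the run of the program.
  module Rendering (Γ : Drawing n a) (pos-Γ : ∀ v → pos Γ v ≡ (+ column v , + T v))
                   (bends-Γ : ∀ e → Traced (src H e) (tgt H e) (bends Γ e)) where

    same-path : ∀ {u v} → column u ≡ column v → pathOf u ≡ pathOf v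
    same-path = column-injective

    path-ascending : ∀ i → AllPairs (λ u v → T u < T v) (path S i)
    path-ascending i = Linked⇒AllPairs <-trans (Linked.map (λ {u} {v} e → s≤s (isTopo u v e)) (directed S i))

    -- Equal columns mean one common path, and disjointness of the paths then excludes the
    -- cross-edge alternative. What remains is an edge between neighbours in a list, to which
    -- `ascending-adjacent` applies.
    path-edge-clear : ∀ e {w} → let u = src H e; v = tgt H e in
                      column u ≡ column v → column w ≡ column u → ¬ (T u < T w × T w < T v)
    path-edge-clear e {w} u≡v w≡u with proj₂ (Equivalence.to (isPDG _ _) (e , refl))
    ... | inj₂ (i , j , u∈ , v∈ , i≢j) =
      contradiction (trans (sym (pathOf-unique u∈)) (trans (same-path u≡v) (pathOf-unique v∈))) i≢j
    ... | inj₁ (i , xs , ys , eq) =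
      ascending-adjacent T xs (subst (AllPairs _) eq (path-ascending i)) (subst (w ∈_) eq w∈)
      where
      u∈ : src H e ∈ path S i
      u∈ = subst (src H e ∈_) (sym eq) (∈-++⁺ʳ xs (here refl))
      w∈ : w ∈ path S i
      w∈ = subst (λ j → w ∈ path S j) (trans (same-path w≡u) (pathOf-unique u∈)) (proj₂ (covers S w))

    module _ (e : Fin a) where
      private
        u = src H e
        v = tgt H e

      OnEdge : ℕ → ℕ → Fin n → Set
      OnEdge s t w = OnInterval s t (column w) (column u) (column v) × OnInterval s t (T w) (T u) (T v)

      -- If a weight were zero, `w` would share its row with an end of the edge, and rows determine
      -- vertices.
      onEdge-interior : ∀ s t {w} → w ≢ u → w ≢ v → s + t > 0 → OnEdge s t w → s > 0 × t > 0
      onEdge-interior zero    t       w≢u w≢v positive (_ , on-y) =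
        contradiction (T-injective (interval-end {a = T u} positive on-y)) w≢v
      onEdge-interior (suc s) zero    {w} w≢u w≢v positive (_ , on-y) =
        contradiction (T-injective (interval-start {suc s} {T w} {T u} {T v} (s≤s z≤n) on-y)) w≢u
      onEdge-interior (suc s) (suc t) w≢u w≢v positive _ = s≤s z≤n , s≤s z≤n

      onEdge⇒crosses : ∀ s t {w} → s > 0 → t > 0 → OnEdge s t w → Crosses u v w × T u < T w × T w < T v
      onEdge⇒crosses s t {w} s>0 t>0 (on-x , on-y) =
        ( interval-between s t s>0 t>0 u≢v on-x , <⇒≤ u<w
        , interval⇒meets s t {column u} {column v} {T u} {T v} s>0 t>0 (edge-T e) on-x on-y) , u<w , w<v
        where
        u<w : T u < T w
        u<w = interval-> s t t>0 (edge-T e) on-y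

        w<v : T w < T v
        w<v = interval-< s t s>0 (edge-T e) on-y

        -- Every point of a vertical edge lies in its column, so `w` would sit strictly inside a
        -- path edge.
        u≢v : column u ≢ column v
        u≢v u≡v = path-edge-clear e u≡v w≡u (u<w , w<v)
          where
          w≡u : column w ≡ column u
          w≡u = *-cancelˡ-≡ _ _ (s + t) {{>-nonZero (<-≤-trans s>0 (m≤m+n s t))}}
            (trans on-x (trans (cong (λ b → s * column u + t * b) (sym u≡v)) (sym (*-distribʳ-+ (column u) s t))))

      blocked⇒crosses : Blocked I Γ e → ∃[ w ] (Crosses u v w × T u < T w × T w < T v)
      blocked⇒crosses (w , w≢u , w≢v , on-edge)
        rewrite pos-Γ w | pos-Γ u | pos-Γ v
        with s , t , positive , on ← onSegment⇒interval on-edge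
        with s>0 , t>0 ← onEdge-interior s t w≢u w≢v positive on
        = w , onEdge⇒crosses s t s>0 t>0 on

      crosses⇒blocked : ∀ {w} → Crosses u v w → Blocked I Γ e
      crosses⇒blocked {w} (between , u≤w , meets) = w , w≢u , w≢v , on-edge
        where
        s = ∣ column v - column w ∣
        t = ∣ column w - column u ∣

        w≢u : w ≢ u
        w≢u refl = between-≢ between refl

        w≢v : w ≢ v
        w≢v refl = between-≢ (Sum.swap between) refl

        on-edge : OnSegment (pos Γ w) (pos Γ u) (pos Γ v)
        on-edge rewrite pos-Γ w | pos-Γ u | pos-Γ v = interval⇒onSegment s t
          (subst (_> 0) (sym (proj₁ (between⇒interval between))) (≤-<-trans z≤n (between-distance between)))
          (proj₂ (between⇒interval between))
          (subst (λ h → OnInterval s t h (T u) (T v)) (m+[n∸m]≡n u≤w)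
            (meets⇒interval (<⇒≤ (edge-T e)) between meets))

    open Bend

    isBend : ∀ e {bx by} → Bend (src H e) (tgt H e) bx by → IsBend I Γ e (+ bx , + by)
    isBend e bend rewrite pos-Γ (src H e) | pos-Γ (tgt H e) =
      (λ u<v → cong +_ (rightward bend (ℤ.drop‿+<+ u<v))) ,
      (λ u≮v → cong +_ (leftward bend (u≮v ∘ +<+))) ,
      cong +_ (below bend)

    followsPCHDraw : FollowsPCHDraw I Γ
    followsPCHDraw = record
      { placement = λ i v v∈ → trans (pos-Γ v) (cong (λ i → + (2 * suc (toℕ i)) , + T v) (pathOf-unique v∈))
      ; straight  = is-straight
      ; bent      = is-bent
      }
      where
      is-straight : ∀ e → ¬ Blocked I Γ e → bends Γ e ≡ []
      is-straight e ¬b with bends Γ e | bends-Γ e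
      ... | _ | straight _ = refl
      ... | _ | bent (_ , cr) _ = contradiction (crosses⇒blocked e cr) ¬b

      is-bent : ∀ e → Blocked I Γ e → ∃[ b ] (bends Γ e ≡ b ∷ [] × IsBend I Γ e b)
      is-bent e b with bends Γ e | bends-Γ e
      ... | _ | straight ¬cr = let w , cr , _ = blocked⇒crosses e b in contradiction (w , cr) ¬cr
      ... | _ | bent _ bend  = _ , refl , isBend e bend

    bend-adjacent : ∀ {u v bx by} → Bend u v bx by → bx ≡ suc (column u) ⊎ suc bx ≡ column u
    bend-adjacent {u} {v} bend with column u <? column v
    ... | yes u<v = inj₁ (trans (rightward bend u<v) (+-comm (column u) 1))
    ... | no  u≮v = inj₂ (cong suc (leftward bend u≮v))

    bend-off-columns : ∀ {u v bx by} → Bend u v bx by → ∀ w → column w ≢ bx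
    bend-off-columns {u} bend w w≡b with bend-adjacent bend
    ... | inj₁ b≡1+u = even≢odd (suc (toℕ (pathOf w))) (suc (toℕ (pathOf u))) (trans w≡b b≡1+u)
    ... | inj₂ 1+b≡u = even≢odd (suc (toℕ (pathOf u))) (suc (toℕ (pathOf w))) (trans (sym 1+b≡u) (cong suc (sym w≡b)))

    -- The segment is one unit wide, so `interval-unit` leaves only its two ends. In the column of
    -- `u` the weight of the bend vanishes, which forces `w` into the row of `u`; the column of the
    -- bend carries no vertex by parity.
    first-segment-clear : ∀ {u v bx by w} → Bend u v bx by → w ≢ u →
                          ¬ OnSegment (+ column w , + T w) (+ column u , + T u) (+ bx , + by)
    first-segment-clear {u} {v} {bx} {by} {w} bend w≢u on
      with s , t , positive , on-x , on-y ← onSegment⇒interval on = clear (bend-adjacent bend)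
      where
      off : column w ≢ bx
      off = bend-off-columns bend w

      at-u : ¬ t ≡ 0
      at-u refl = w≢u (T-injective (interval-start {s} {T w} {T u} {by} (subst (_> 0) (+-identityʳ s) positive) on-y))

      clear : ¬ (bx ≡ suc (column u) ⊎ suc bx ≡ column u)
      clear (inj₁ b≡1+u) with interval-unit s t positive (subst (OnInterval s t (column w) (column u)) b≡1+u on-x)
      ... | inj₁ (_ , t≡0) = at-u t≡0
      ... | inj₂ (w≡1+u , _) = off (trans w≡1+u (sym b≡1+u))
      -- A bend to the left reverses the interval, so the weights are swapped first.
      clear (inj₂ 1+b≡u) with interval-unit t s (subst (_> 0) (+-comm s t) positive)
        (interval-swap s t (subst (λ c → OnInterval s t (column w) c bx) (sym 1+b≡u) on-x))
      ... | inj₁ (w≡b , _) = off w≡b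
      ... | inj₂ (_ , t≡0) = at-u t≡0

    -- Now the rows play the part of the columns: `T v` is a successor, so the segment is one unit
    -- high. A vertex on it in the row of the bend would have to lie at the bend itself, which
    -- parity excludes.
    second-segment-clear : ∀ {u v bx by w} → Bend u v bx by → w ≢ v →
                           ¬ OnSegment (+ column w , + T w) (+ bx , + by) (+ column v , + T v)
    second-segment-clear {u} {v} {bx} {by} {w} bend w≢v on
      with s , t , positive , on-x , on-y ← onSegment⇒interval on
      with interval-unit s t positive (subst (λ c → OnInterval s t (T w) c (T v)) (below bend) on-y)
    ... | inj₂ (w≡v , _)    = w≢v (T-injective w≡v)
    ... | inj₁ (_ , refl)   = bend-off-columns bend w
      (interval-start {s} {column w} {bx} {column v} (subst (_> 0) (+-identityʳ s) positive) on-x)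

    hierarchical : IsHierarchicalDrawing H Γ
    hierarchical = record
      { distinct = λ {u} {v} eq → T-injective (ℤ.+-injective
          (cong proj₂ (trans (sym (pos-Γ u)) (trans eq (pos-Γ v)))))
      ; avoids   = avoiding
      ; upward   = ascending
      }
      where
      avoiding : ∀ e w → w ≢ src H e → w ≢ tgt H e →
                 Linked (λ p q → ¬ OnSegment (pos Γ w) p q) (polyline H Γ e)
      avoiding e w w≢u w≢v with bends Γ e | bends-Γ e
      ... | _ | straight ¬cr =
        (λ on → let z , cr , _ = blocked⇒crosses e (w , w≢u , w≢v , on) in ¬cr (z , cr)) ∷ [-]
      ... | _ | bent _ bend rewrite pos-Γ w | pos-Γ (src H e) | pos-Γ (tgt H e) =
        first-segment-clear bend w≢u ∷ second-segment-clear bend w≢v ∷ [-]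

      ascending : ∀ e → Linked (λ p q → Y p ℤ.< Y q) (polyline H Γ e)
      ascending e with bends Γ e | bends-Γ e
      ... | _ | straight _ rewrite pos-Γ (src H e) | pos-Γ (tgt H e) = +<+ (edge-T e) ∷ [-]
      ... | _ | bent (_ , cr) bend
        with _ , _ , u<w , w<v ← blocked⇒crosses e (crosses⇒blocked e cr)
        rewrite pos-Γ (src H e) | pos-Γ (tgt H e) | below bend
        = +<+ (<-≤-trans u<w (s≤s⁻¹ w<v)) ∷ +<+ ≤-refl ∷ [-]

    isPCHDrawing : IsPCHDrawing S H Γ
    isPCHDrawing = record
      { hierarchical = hierarchical
      ; columns      = λ u v → mk⇔
          (λ eq → pathOf v
            , subst (λ i → u ∈ path S i) (same-path (x-injective u v eq)) (proj₂ (covers S u))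
            , proj₂ (covers S v))
          (λ (i , u∈ , v∈) → trans (cong X (pos-Γ u)) (trans
            (cong (λ i → + (2 * suc (toℕ i))) (trans (pathOf-unique u∈) (sym (pathOf-unique v∈))))
            (sym (cong X (pos-Γ v)))))
      }
      where
      x-injective : ∀ u v → X (pos Γ u) ≡ X (pos Γ v) → column u ≡ column v
      x-injective u v eq = ℤ.+-injective (trans (sym (cong X (pos-Γ u))) (trans eq (cong X (pos-Γ v))))

  open Rendering (drawing I) pos-drawing bends-drawing

  faithful : FollowsPCHDraw I (drawing I) × IsPCHDrawing S H (drawing I)
  faithful = followsPCHDraw , isPCHDrawing

-- Area and running time

Bounded : ℕ → ℤ → Set
Bounded B z = ∃[ i ] (i ≤ B × z ≡ + i)

-- Maximum and minimum each select one of their arguments, so both folds stay between 0 and `B`.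
-- Their difference is at most `B`, and `extent` counts one line more.
extent-bounded : ∀ {B zs} → All (Bounded B) zs → extent zs ≤ suc B
extent-bounded [] = z≤n
extent-bounded {B} {z ∷ zs} (bz ∷ bzs)
  with foldr ℤ._⊔_ z zs | foldr ℤ._⊓_ z zs | fold ℤ.⊔-sel bzs | fold ℤ.⊓-sel bzs
  where
  fold : ∀ {_∙_ : ℤ → ℤ → ℤ} → (∀ i j → (i ∙ j ≡ i) ⊎ (i ∙ j ≡ j)) →
         ∀ {zs} → All (Bounded B) zs → Bounded B (foldr _∙_ z zs)
  fold sel []                 = bz
  fold sel {z′ ∷ zs} (b ∷ bs) = Sum.[ (λ eq → subst (Bounded B) (sym eq) b)
                                    , (λ eq → subst (Bounded B) (sym eq) (fold sel bs)) ] (sel z′ _)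
... | _ | _ | i , i≤B , refl | j , j≤B , refl =
  s≤s (subst (λ z → ℤ.∣ z ∣ ≤ B) (sym (ℤ.[+m]-[+n]≡m⊖n i j)) (≤-trans (ℤ.∣m⊝n∣≤m⊔n i j) (⊔-lub i≤B j≤B)))

unique-length : ∀ {n} {vs : List (Fin n)} → Unique vs → length vs ≤ n
unique-length unique = injective⇒≤ (lookup-injective unique)
  where
  lookup-injective : ∀ {vs : List _} → Unique vs → ∀ {i j} → lookup vs i ≡ lookup vs j → i ≡ j
  lookup-injective (_ ∷ _)   {Fin.zero}  {Fin.zero}  _  = refl
  lookup-injective (v∉ ∷ _)  {Fin.zero}  {Fin.suc j} eq = contradiction eq (All.lookup v∉ (∈-lookup j))
  lookup-injective (v∉ ∷ _)  {Fin.suc i} {Fin.zero}  eq = contradiction (sym eq) (All.lookup v∉ (∈-lookup i))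
  lookup-injective (_ ∷ vs!) {Fin.suc i} {Fin.suc j} eq = cong Fin.suc (lookup-injective vs! eq)

module Size (I : Input) where
  open Input I
  open Execution I

  -- Each edge of `H` has a copy in `G`; as `H` has no parallel edges, the choice of copies is
  -- injective.
  a≤m : a ≤ m
  a≤m = injective⇒≤ {f = λ e → proj₁ (edge-of e)} λ {e} {e′} eq → edge-inj H
    (trans (sym (proj₂ (edge-of e))) (trans (cong (edge G) eq) (proj₂ (edge-of e′))))
    where
    edge-of : ∀ e → _⟶_ G (src H e) (tgt H e)
    edge-of e = proj₁ (Equivalence.to (isPDG _ _) (e , refl))

  -- Choosing a vertex on each nonempty path is injective because the paths are disjoint.
  k≤n : k ≤ n
  k≤n = injective⇒≤ {f = λ i → proj₁ (member i)} λ {i} {j} eq →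
    disjoint S (proj₂ (member i)) (subst (_∈ path S j) (sym eq) (proj₂ (member j)))
    where
    nonempty-member : ∀ {vs : List (Fin n)} → vs ≢ [] → ∃[ v ] v ∈ vs
    nonempty-member {[]}     ≢[] = contradiction refl ≢[]
    nonempty-member {v ∷ vs} _   = v , here refl

    member : ∀ i → ∃[ v ] v ∈ path S i
    member i = nonempty-member (nonEmpty S i)

  -- The concatenated paths repeat no vertex: each path is simple and distinct paths are disjoint.
  starts-k≤n : starts k ≤ n
  starts-k≤n = subst (_≤ n) (sym starts-k) (unique-length
    (Unique.concat⁺ (All.tabulate⁺ (simple S))
      (AllPairs.tabulate⁺ λ i≢j (v∈i , v∈j) → i≢j (disjoint S v∈i v∈j))))

  k>0 : n > 0 → k > 0
  k>0 n>0 = ≤-<-trans z≤n (toℕ<n (pathOf (fromℕ< n>0)))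

  column≤2k : ∀ v → column v ≤ 2 * k
  column≤2k v = *-monoʳ-≤ 2 (toℕ<n (pathOf v))

  bend≤ : ∀ {u v bx by} → Bend u v bx by → bx ≤ suc (2 * k) × by ≤ n
  bend≤ {u} {v} bend with column u <? column v
  ... | yes u<v rewrite Bend.rightward bend u<v | Bend.below bend =
    subst (_≤ suc (2 * k)) (+-comm 1 (column u)) (s≤s (column≤2k u)) , ≤-trans (m∸n≤m (T v) 1) (T≤n v)
  ... | no u≮v rewrite Bend.leftward bend u≮v | Bend.below bend =
    ≤-trans (m∸n≤m (column u) 1) (m≤n⇒m≤1+n (column≤2k u)) , ≤-trans (m∸n≤m (T v) 1) (T≤n v)

  drawn-bounded : All (λ p → Bounded (suc (2 * k)) (X p) × Bounded n (Y p)) (drawnPoints (drawing I))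
  drawn-bounded = All.++⁺
    (All.tabulate⁺ λ v → subst Inside (sym (pos-drawing v))
      ((column v , m≤n⇒m≤1+n (column≤2k v) , refl) , (T v , T≤n v , refl)))
    (All.concat⁺ (All.tabulate⁺ λ e → traced-inside (bends-drawing e)))
    where
    Inside : Point → Set
    Inside p = Bounded (suc (2 * k)) (X p) × Bounded n (Y p)

    traced-inside : ∀ {u v ps} → Traced u v ps → All Inside ps
    traced-inside (straight _)  = []
    traced-inside (bent _ bend) = ((_ , proj₁ (bend≤ bend) , refl) , (_ , proj₂ (bend≤ bend) , refl)) ∷ []

  -- The abscissas of vertices and bends lie in 0..2k+1 and the ordinates in 0..n, so the extents
  -- are at most 2k+2 and n+1. For k, n ≥ 1 these are at most 4k and 2n, whence the factor 8.
  area-bound : n > 0 → Area (drawing I) ≤ 8 * (k * n)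
  area-bound n>0 = begin
    Area (drawing I)                    ≤⟨ *-mono-≤ (extent-bounded (All.map⁺ (All.map proj₁ drawn-bounded)))
                                                    (extent-bounded (All.map⁺ (All.map proj₂ drawn-bounded))) ⟩
    (2 + 2 * k) * (1 + n)               ≤⟨ *-mono-≤ (+-monoˡ-≤ (2 * k) (*-monoʳ-≤ 2 (k>0 n>0))) (+-monoˡ-≤ n n>0) ⟩
    (2 * k + 2 * k) * (n + n)           ≡⟨ collect k n ⟩
    8 * (k * n)                         ∎
    where
    open ≤-Reasoning
    collect : ∀ k n → (2 * k + 2 * k) * (n + n) ≡ 8 * (k * n)
    collect = solve-∀

  -- Step counts

  placePath-steps : ∀ i σ → steps (placePath i) σ ≤ 7 + (σ start (i + 1) ∸ σ start i) * 9
  placePath-steps i = steps-For {start [ ` i ]} {start [ ` i ⊕ lit 1 ]} {placeVertex i} λ j → takes-assign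

  -- A uniform bound per path would charge every path for the longest one. Charging each path its
  -- own length instead makes the sum telescope along `starts`.
  placeColumns-steps : steps placeColumns (memory I) ≤ 3 + (k * 8 + starts k * 9)
  placeColumns-steps = +-monoʳ-≤ 3 (loop-steps (λ i → Columns (starts i)) budget k 0 (exec ∘ placePath)
    (λ i σ _ i<k → fromℕ<-elim
      (λ i → Columns (starts i) σ → Columns (starts (suc i)) (run (placePath i) σ)
           × budget i + suc (steps (placePath i) σ) ≤ budget (suc i))
      (λ i init → placePath-columns i init , amortised i init) i<k)
    (memory I) ((λ _ → refl) , λ _ ()))
    where
    budget : ℕ → ℕ
    -- A path pays 7 for entering its loop and 1 for the outer iteration; each of its vertices pays
    -- 8 for the assignment and 1 for the inner iteration.
    budget i = i * 8 + starts i * 9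

    amortised : ∀ (i : Fin k) {σ} → Columns (starts (toℕ i)) σ →
                budget (toℕ i) + suc (steps (placePath (toℕ i)) σ) ≤ budget (suc (toℕ i))
    amortised i {σ} (keeps , _) = begin
      budget (toℕ i) + suc (steps (placePath (toℕ i)) σ)
        ≤⟨ +-monoʳ-≤ (budget (toℕ i)) (s≤s (placePath-steps (toℕ i) σ)) ⟩
      budget (toℕ i) + (8 + (σ start (toℕ i + 1) ∸ σ start (toℕ i)) * 9)
        ≡⟨ cong (λ l → budget (toℕ i) + (8 + l * 9)) path-length ⟩
      budget (toℕ i) + (8 + length (path S i) * 9)
        ≡⟨ regroup (toℕ i) (starts (toℕ i)) (length (path S i)) ⟩
      suc (toℕ i) * 8 + (starts (toℕ i) + length (path S i)) * 9
        ≡⟨ cong (λ s → suc (toℕ i) * 8 + s * 9) (starts-suc i) ⟨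
      budget (suc (toℕ i)) ∎
      where
      open ≤-Reasoning hiding (start)
      regroup : ∀ i s l → i * 8 + s * 9 + (8 + l * 9) ≡ (1 + i) * 8 + (s + l) * 9
      regroup = solve-∀

      path-length : σ start (toℕ i + 1) ∸ σ start (toℕ i) ≡ length (path S i)
      path-length = trans
        (cong₂ _∸_ (trans (keeps λ ()) (trans (cong starts (+-comm (toℕ i) 1)) (starts-suc i))) (keeps λ ()))
        (m+n∸m≡n (starts (toℕ i)) (length (path S i)))

  placeRows-steps : Takes placeRows (3 + n * 9)
  placeRows-steps = takes-For λ v → takes-⨾ takes-assign takes-assign

  testColumn-takes : ∀ e u v c → Takes (testColumn e u v c) 70
  testColumn-takes e u v c = takes-when (takes-Let λ p → takes-Let λ q → takes-Let λ h → takes-when takes-assign takes-skip) takes-skip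

  placeBend-takes : ∀ e u v → Takes (placeBend e u v) 18
  placeBend-takes e u v = takes-⨾ (takes-when takes-assign takes-assign) takes-assign

  routeEdge-takes : ∀ e → Takes (routeEdge e) (9 + ((3 + k * 77) + 21))
  routeEdge-takes e = takes-Let λ u → takes-Let λ v → takes-⨾ takes-assign
    (takes-⨾ (takes-For λ i → takes-Let λ c → testColumn-takes e u v c)
      (takes-when (placeBend-takes e u v) takes-skip))

  -- An edge costs 34 steps besides the 77 for each scanned column; since k ≥ 1, the 34 is absorbed
  -- into the product m * k, and 34 + 77 = 111. The headers of the three outermost loops cost 9
  -- steps even on an empty graph, and n ≥ 1 absorbs them.
  time-bound : n > 0 → time I ≤ 111 * (n + m * k)
  time-bound n>0 = begin
    time I
      ≤⟨ +-mono-≤ (+-mono-≤ placeColumns-steps (bound placeRows-steps _)) (bound (takes-For {a} routeEdge-takes) _) ⟩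
    (3 + (k * 8 + starts k * 9)) + (3 + n * 9) + (3 + a * (10 + ((3 + k * 77) + 21)))
      ≤⟨ +-mono-≤ (+-monoˡ-≤ (3 + n * 9) (+-monoʳ-≤ 3 (+-mono-≤ (*-monoˡ-≤ 8 k≤n) (*-monoˡ-≤ 9 starts-k≤n))))
                  (+-monoʳ-≤ 3 (*-monoˡ-≤ (10 + ((3 + k * 77) + 21)) a≤m)) ⟩
    (3 + (n * 8 + n * 9)) + (3 + n * 9) + (3 + m * (10 + ((3 + k * 77) + 21)))
      ≡⟨ collect n m k ⟩
    9 * 1 + (26 * n + 34 * (m * 1) + 77 * (m * k))
      ≤⟨ +-mono-≤ (*-monoʳ-≤ 9 n>0) (+-monoˡ-≤ (77 * (m * k)) (+-monoʳ-≤ (26 * n) (*-monoʳ-≤ 34 (*-monoʳ-≤ m (k>0 n>0))))) ⟩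
    9 * n + (26 * n + 34 * (m * k) + 77 * (m * k))
      ≡⟨ regroup n (m * k) ⟩
    35 * n + 111 * (m * k)
      ≤⟨ +-monoˡ-≤ (111 * (m * k)) (*-monoˡ-≤ n (m≤m+n 35 76)) ⟩
    111 * n + 111 * (m * k)
      ≡⟨ *-distribˡ-+ 111 n (m * k) ⟨
    111 * (n + m * k) ∎
    where
    open ≤-Reasoning
    collect : ∀ n m k → (3 + (n * 8 + n * 9)) + (3 + n * 9) + (3 + m * (10 + ((3 + k * 77) + 21)))
              ≡ 9 * 1 + (26 * n + 34 * (m * 1) + 77 * (m * k))
    collect = solve-∀
    regroup : ∀ n z → 9 * n + (26 * n + 34 * z + 77 * z) ≡ 35 * n + 111 * z
    regroup = solve-∀

theorem1 :
  ((I : Input) → FollowsPCHDraw I (drawing I)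
               × IsPCHDrawing (Input.S I) (Input.H I) (drawing I))
  × (time =O (λ I → Input.n I + Input.m I * Input.k I))
  × ((λ I → Area (drawing I)) =O (λ I → Input.k I * Input.n I))
theorem1 =
  Execution.faithful
  , (111 , 1 , Size.time-bound)
  , (8 , 1 , Size.area-bound)
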